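{- Let $p$ be an odd prime and $\alpha\geqslant 1$ an integer, and let $X\subseteq\mathbb{Z}_{p^\alpha}\setminus\{0\}$. Then the dihedrant $Dih(p^\alpha,X,X)$ is a (genuine) directed strongly regular graph if and only if $X=\psi_{\gamma}^{ -1}(H)$ for some $1\leqslant\gamma\leqslant\alpha$ and some subset $H\subseteq\mathbb{Z}_{p^\gamma}$ satisfying: (i) $H\cup(-H)=\mathbb{Z}_{p^\gamma}\setminus\{0\}$; (ii) $H\cap(-H)=\emptyset$.
   Context: For a positive integer $n$, $D_n=\langle x,a\mid x^n=1,\ a^2=1,\ ax=x^{ -1}a\rangle$ is the dihedral group of order $2n$. For $X,Y\subseteq\mathbb{Z}_n$ with $0\notin X$, $Dih(n,X,Y)$ denotes the Cayley digraph $\mathbf{Cay}(D_n,S)$ with $S=\{x^i:i\in X\}\cup\{x^ja:j\in Y\}$: its vertex set is $D_n$ and $g\to h$ is an arc iff $g^{ -1}h\in S$. A directed strongly regular graph (DSRG) with parameters $(n,k,\mu,\lambda,t)$ is a digraph on $n$ vertices whose adjacency matrix $A$ satisfies $AJ=JA=kJ$ and $A^2=tI+\lambda A+\mu(J-I-A)$ ($J$ the all-ones matrix); throughout, DSRGs are required to be genuine, i.e. $0<t<k$. For $1\leqslant\gamma\leqslant\alpha$, $\psi_\gamma:\mathbb{Z}_{p^\alpha}\to\mathbb{Z}_{p^\gamma}$ is the reduction-mod-$p^\gamma$ homomorphism (kernel $p^\gamma\mathbb{Z}_{p^\alpha}$), and $\psi_\gamma^{ -1}(H)$ is the full preimage of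 $H$. -}

module Defs where

open import Data.Nat using (ℕ; zero; suc; _+_; _*_; _∸_; _^_; _<_; NonZero)
open import Data.Nat.DivMod using (_mod_)
open import Data.Nat.Properties using (m^n≢0)
open import Data.Nat.Primality using (Prime; prime⇒nonZero)
open import Data.Fin using (Fin; toℕ) renaming (zero to fzero)
open import Data.Fin.Subset using (Subset; _∈_; _∉_)
open import Data.Fin.Subset.Properties using (_∈?_)
open import Data.Bool using (Bool; true; false; _∧_; _xor_; if_then_else_)
open import Data.Product using (_×_; _,_)
open import Data.List using (List; []; _∷_; length; filter; allFin; concatMap)
open import Data.Integer as ℤ using (ℤ; +_)
open import Relation.Binary.PropositionalEquality using (_≡_)
open import Relation.Binary.Definitions using (DecidableEquality)
open import Relation.Nullary using (does; ¬_)
open import Relation.Nullary.Decidable using (⌊_⌋)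
import Data.Fin.Properties as FinP
import Data.Bool.Properties as BoolP
open import Data.Product.Properties using (≡-dec)

_+ₙ_ : ∀ {n} → Fin n → Fin n → Fin n
_+ₙ_ {suc m} i j = (toℕ i + toℕ j) mod (suc m)

-ₙ_ : ∀ {n} → Fin n → Fin n
-ₙ_ {suc m} i = (suc m ∸ toℕ i) mod (suc m)

-- -H = { -h : h ∈ H }, expressed pointwise: y ∈ -H  iff  -y ∈ H
_∈-_ : ∀ {n} → Fin n → Subset n → Set
y ∈- H = (-ₙ y) ∈ H

-- The reduction homomorphism ψ_γ : ℤ_{p^α} → ℤ_{p^γ}, x ↦ x mod p^γ.
-- (The primality proof only serves to know p^γ ≠ 0.)


ψ : ∀ {p N} → Prime p → (γ : ℕ) → Fin N → Fin (p ^ γ)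
ψ {p} pr γ x = _mod_ (toℕ x) (p ^ γ) {{m^n≢0 p γ {{prime⇒nonZero pr}}}}

-- The dihedral group D_n of order 2n.
-- (i , false) represents x^i, (i , true) represents x^i a.

D : ℕ → Set
D n = Fin n × Bool

-- x^{-i} if b = true, x^i otherwise (conjugation by a)
twist : ∀ {n} → Bool → Fin n → Fin n
twist false j = j
twist true  j = -ₙ j

-- (x^i a^b)(x^j a^c) = x^{i + (-1)^b j} a^{b xor c}
_·_ : ∀ {n} → D n → D n → D n
(i , b) · (j , c) = (i +ₙ twist b j) , (b xor c)

inv : ∀ {n} → D n → D n
inv (i , false) = (-ₙ i) , false
inv (i , true)  = i , true

allD : (n : ℕ) → List (D n)
allD n = concatMap (λ i → (i , false) ∷ (i , true) ∷ []) (allFin n)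

_≟D_ : ∀ {n} → DecidableEquality (D n)
_≟D_ = ≡-dec FinP._≟_ BoolP._≟_

inS : ∀ {n} → Subset n → Subset n → D n → Bool
inS X Y (i , false) = does (i ∈? X)
inS X Y (j , true)  = does (j ∈? Y)

-- Dih(n,X,Y) = Cay(D_n, S): g → h iff g^{-1} h ∈ S
dihArc : ∀ {n} → Subset n → Subset n → D n → D n → Bool
dihArc X Y g h = inS X Y (inv g · h)

count : ∀ {V : Set} → List V → (V → Bool) → ℕ
count vs P = length (filter (λ v → BoolP._≟_ (P v) true) vs)

ind : Bool → ℤ
ind true  = + 1
ind false = + 0

-- A is the adjacency matrix; the conditions are AJ = JA = kJ and
-- A² = tI + λA + μ(J − I − A) entrywise (in ℤ), and 0 < t < k.
record IsDSRG {V : Set} (vs : List V) (_≟_ : DecidableEquality V)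
              (adj : V → V → Bool) (v k μ lam t : ℕ) : Set where
  field
    order   : length vs ≡ v
    outReg  : ∀ x → count vs (λ y → adj x y) ≡ k
    inReg   : ∀ y → count vs (λ x → adj x y) ≡ k
    square  : ∀ x y →
      + count vs (λ z → adj x z ∧ adj z y)
        ≡ (+ t ℤ.* ind ⌊ x ≟ y ⌋) ℤ.+ (+ lam ℤ.* ind (adj x y))
          ℤ.+ (+ μ ℤ.* (+ 1 ℤ.- ind ⌊ x ≟ y ⌋ ℤ.- ind (adj x y)))
    t-pos   : 0 < t
    t<k     : t < k

record DSRGParams : Set where
  constructor params
  field v k μ lam t : ℕ

IsDSRGDih : (n : ℕ) → Subset n → Subset n → Set
IsDSRGDih n X Y = Data.Product.Σ DSRGParams λ π →
  IsDSRG (allD n) _≟D_ (dihArc X Y)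
    (DSRGParams.v π) (DSRGParams.k π) (DSRGParams.μ π) (DSRGParams.lam π) (DSRGParams.t π)
  where import Data.Product

{-# OPTIONS --safe #-}
module Submission where

-- In the group ring of G = ℤ_n, n = p^α, Dih(n,X,X) is a directed strongly regular graph iff
-- X(X + X⁽⁻¹⁾) = μG − cX with 0 < μ < 2|X|.  Then Y = X + X⁽⁻¹⁾ satisfies Y² = 2μG − cY, so
-- Σ (Y(i) − Y(i+g))² = 2c(Y(g) − Y(0)): since Y(0) = 0, every zero of Y is a period of Y and of X.
-- By the freshman's dream Y^p ≡ Σ Y(i) [p i] modulo p, while Y^p = (−c)^(p−1) Y + βG.
-- If p ∤ c, comparing coefficients shows that Y is constant modulo p off 0; as Y takes values in
-- {0,1,2}, it is constant there, and the constant must be 1.  If p ∣ c, the coefficient at 0 shows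
-- that p divides the number of elements of X in the subgroup of order p, so X avoids this subgroup,
-- is a union of its cosets, and the equation descends to ℤ_{p^(α−1)}.
-- Conversely, if X is the preimage of H then X + X⁽⁻¹⁾ = G − ker ψ_γ and the equation is immediate.
-- Subsets of ℤ_n are handled as n-periodic functions ℤ → {0,1}, so that descending to a quotient
-- only means having a smaller period.

open import Algebra.Bundles using (Semiring)
open import Data.Fin using (Fin; zero; suc; toℕ; fromℕ; inject₁)
open import Data.Fin.Properties using (toℕ<n; toℕ-fromℕ; toℕ-inject₁)
open import Data.Nat using (ℕ; zero; suc; _∸_; _≤_; _<_; s≤s; z≤n; _!; NonZero)
open import Data.Nat.Combinatorics using (_C_; nCn≡1; nCk≡n!/k![n-k]!; k![n∸k]!∣n!)
open import Data.Nat.Primality using (Prime; euclidsLemma; prime⇒nonTrivial)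
open import Data.Product using (Σ; _,_; proj₁; proj₂; ∃-syntax)
open import Data.Sum using (inj₁; inj₂)
open import Function using (_∘_)
open import Level using (Level)
open import Relation.Binary.PropositionalEquality using (_≡_; cong; cong₂; subst)
open import Relation.Nullary using (¬_; contradiction)
import Algebra.Properties.CommutativeMonoid.Mult
import Algebra.Properties.Semiring.Binomial
import Algebra.Properties.Semiring.Exp
import Algebra.Properties.Semiring.Mult
import Algebra.Properties.Semiring.Sum
import Data.Integer as ℤ
import Data.Integer.Properties as ℤ
import Data.Nat as ℕ
import Data.Nat.Divisibility as ℕ
import Data.Nat.DivMod as ℕ
import Data.Nat.Properties as ℕ
import Relation.Binary.PropositionalEquality as ≡
import Relation.Binary.Reasoning.Setoid

-- The freshman's dream in a semiring

p∤k! : ∀ {p} → Prime p → ∀ k → k < p → ¬ (p ℕ.∣ k !)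
p∤k! pr zero    0<p p∣1 = ℕ.>⇒∤ (ℕ.nonTrivial⇒n>1 _ {{prime⇒nonTrivial pr}}) p∣1
p∤k! pr (suc k) k<p p∣k! with euclidsLemma (suc k) (k !) pr p∣k!
... | inj₁ p∣1+k = ℕ.>⇒∤ k<p p∣1+k
... | inj₂ p∣k!′ = p∤k! pr k (ℕ.<-trans (ℕ.n<1+n k) k<p) p∣k!′

-- The prime `p` divides `p ! = (p C k) * (k ! * (p ∸ k) !)` but neither factorial on the right, as
-- both are products of numbers below `p`.
p∣pCk : ∀ {p} → Prime p → ∀ k → 0 < k → k < p → p ℕ.∣ p C k
p∣pCk {p@(suc q)} pr k 0<k k<p with euclidsLemma (p C k) (k ! ℕ.* (p ∸ k) !) pr p∣C*k!
  where
  instance _ = k ℕ.!* (p ∸ k) !≢0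
  C*k!≡p! : (p C k) ℕ.* (k ! ℕ.* (p ∸ k) !) ≡ p !
  C*k!≡p! = ≡.trans (cong (ℕ._* (k ! ℕ.* (p ∸ k) !)) (nCk≡n!/k![n-k]! (ℕ.<⇒≤ k<p)))
    (ℕ.m/n*n≡m (k![n∸k]!∣n! (ℕ.<⇒≤ k<p)))
  p∣C*k! : p ℕ.∣ (p C k) ℕ.* (k ! ℕ.* (p ∸ k) !)
  p∣C*k! = subst (p ℕ.∣_) (≡.sym C*k!≡p!) (ℕ.m∣m*n (q !))
... | inj₁ p∣C = p∣C
... | inj₂ p∣k!l! with euclidsLemma (k !) ((p ∸ k) !) pr p∣k!l!
... | inj₁ p∣k! = contradiction p∣k! (p∤k! pr k k<p)
... | inj₂ p∣l! = contradiction p∣l! (p∤k! pr (p ∸ k) (ℕ.∸-monoʳ-< 0<k (ℕ.<⇒≤ k<p)))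

module FreshmansDream {a ℓ : Level} (S : Semiring a ℓ) where
  open Semiring S hiding (zero)
  open Algebra.Properties.CommutativeMonoid.Mult +-commutativeMonoid using (×-distrib-+)
  open Algebra.Properties.Semiring.Exp S using (_^_)
  open Algebra.Properties.Semiring.Mult S using (_×_; ×-congʳ; ×-assocˡ; ×-homo-1; ×-assoc-*)
  open Algebra.Properties.Semiring.Sum S using (sum; sum-init-last)
  open Relation.Binary.Reasoning.Setoid setoid

  sum-multiple : ∀ m {n} (f : Fin n → Carrier) → (∀ i → ∃[ r ] f i ≈ m × r) →
    ∃[ r ] sum f ≈ m × r
  sum-multiple m {zero}  f h = 0# , trans (sym (zeroʳ (m × 1#)))
    (trans (×-assoc-* m 1# 0#) (×-congʳ m (*-identityˡ 0#)))
  sum-multiple m {suc n} f h with h zero | sum-multiple m (f ∘ suc) (h ∘ suc)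
  ... | r , f0≈mr | s , ∑f≈ms = r + s , trans (+-cong f0≈mr ∑f≈ms) (sym (×-distrib-+ r s m))

  -- The outer binomial terms are the two powers, and every inner coefficient is a multiple of `p`.
  -- Only `x` and `y` have to commute: besides ℤ, this is applied in the noncommutative semiring of
  -- additive operators.
  freshmansDream : ∀ {p} → Prime p → ∀ x y → x * y ≈ y * x →
    ∃[ r ] (x + y) ^ p ≈ (x ^ p + y ^ p) + p × r
  freshmansDream {p@(suc q)} pr x y xy≈yx = r , (begin
    (x + y) ^ p                               ≈⟨ theorem xy≈yx p ⟩
    t zero + sum (t ∘ suc)                    ≈⟨ +-cong first (sum-init-last (t ∘ suc)) ⟩
    y ^ p + (sum middle + t (suc (fromℕ q)))  ≈⟨ +-congˡ (+-cong middle≈ last) ⟩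
    y ^ p + (p × r + x ^ p)                   ≈⟨ +-comm _ _ ⟩
    (p × r + x ^ p) + y ^ p                   ≈⟨ +-assoc _ _ _ ⟩
    p × r + (x ^ p + y ^ p)                   ≈⟨ +-comm _ _ ⟩
    (x ^ p + y ^ p) + p × r                   ∎)
    where
    open Algebra.Properties.Semiring.Binomial S x y using (binomial; binomialTerm; theorem)
    t : Fin (suc p) → Carrier
    t = binomialTerm p
    middle : Fin q → Carrier
    middle i = t (suc (inject₁ i))
    first : t zero ≈ y ^ p
    first = trans (×-homo-1 _) (*-identityˡ _)
    last : t (suc (fromℕ q)) ≈ x ^ p
    last = begin
      (p C suc (toℕ (fromℕ q))) × (x ^ suc (toℕ (fromℕ q)) * y ^ (p ∸ suc (toℕ (fromℕ q))))
        ≡⟨ cong (λ k → (p C suc k) × (x ^ suc k * y ^ (q ∸ k))) (toℕ-fromℕ q) ⟩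
      (p C p) × (x ^ p * y ^ (q ∸ q))
        ≡⟨ cong₂ (λ k l → k × (x ^ p * y ^ l)) (nCn≡1 p) (ℕ.n∸n≡0 q) ⟩
      1 × (x ^ p * 1#)  ≈⟨ ×-homo-1 _ ⟩
      x ^ p * 1#        ≈⟨ *-identityʳ _ ⟩
      x ^ p             ∎
    multiple : ∀ i → ∃[ r ] middle i ≈ p × r
    multiple i with p∣pCk pr (suc (toℕ (inject₁ i))) (s≤s z≤n)
                      (s≤s (subst (_< q) (≡.sym (toℕ-inject₁ i)) (toℕ<n i)))
    ... | ℕ.divides c C≡c*p = c × b , (begin
      (p C suc (toℕ (inject₁ i))) × b  ≡⟨ cong (_× b) (≡.trans C≡c*p (ℕ.*-comm c p)) ⟩
      (p ℕ.* c) × b                    ≈⟨ ×-assocˡ b p c ⟨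
      p × (c × b)                      ∎)
      where b = binomial p (suc (inject₁ i))
    r = proj₁ (sum-multiple p middle multiple)
    middle≈ = proj₂ (sum-multiple p middle multiple)

open import Defs
open import Algebra.Properties.AbelianGroup ℤ.+-0-abelianGroup using (∙-cancelʳ)
open import Algebra.Properties.CommutativeMonoid.Sum ℤ.+-0-commutativeMonoid using (sum; sum-cong-≗)
open import Algebra.Properties.Semiring.Exp ℤ.+-*-semiring using () renaming (_^_ to _^ᶻ_)
open import Data.Bool using (Bool; true; false; _∧_; _xor_)
open import Data.Fin using (fromℕ<)
open import Data.Fin.Properties using (toℕ-fromℕ<; toℕ-injective)
open import Data.Fin.Subset using (Subset; _∈_; _∉_)
open import Data.Fin.Subset.Properties using (_∈?_)
open import Data.Integer using (ℤ; +_; -[1+_]; _+_; _*_; -_; _-_; 0ℤ; 1ℤ; +≤+; +<+; ∣_∣; _%ℕ_; _/ℕ_)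
open import Data.Integer.Divisibility.Signed using (_∣_; divides; _∣?_; ∣⇒∣ᵤ; ∣ᵤ⇒∣; ∣-refl; ∣-trans; ∣m∣n⇒∣m+n; ∣m∣n⇒∣m-n; ∣m⇒∣-m; ∣m⇒∣m*n; ∣n⇒∣m*n; ∣m+n∣n⇒∣m; *-cancelˡ-∣; *-monoʳ-∣)
open import Data.Integer.DivMod using (n%ℕd<d; a≡a%ℕn+[a/ℕn]*n)
open import Data.Integer.Tactic.RingSolver using (solve-∀)
open import Data.List using ([]; _∷_; concatMap; length) renaming (tabulate to tabulateᴸ)
open import Data.Nat using (_^_; _%_)
open import Data.Nat.DivMod using (_mod_)
open import Data.Nat.Primality using (prime⇒nonZero; ¬prime[1])
open import Data.Product using (_×_)
open import Data.Sum using (_⊎_; [_,_]′)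
open import Data.Vec using (tabulate)
open import Data.Vec.Properties using (lookup∘tabulate; []=⇒lookup; lookup⇒[]=)
open import Function.Bundles using (_⇔_; mk⇔; Equivalence)
open import Level using (0ℓ)
open import Relation.Binary.PropositionalEquality using (refl; sym; trans; subst₂; module ≡-Reasoning)
open import Relation.Nullary using (Dec; yes; no; does)
open import Relation.Nullary.Decidable using (⌊_⌋; toSum)

open ≡-Reasoning

-- Sums of periodic functions

∑ : ℕ → (ℤ → ℤ) → ℤ
∑ zero    f = 0ℤ
∑ (suc n) f = ∑ n f + f (+ n)

∑-cong : ∀ n {f g} → (∀ x → f x ≡ g x) → ∑ n f ≡ ∑ n g
∑-cong zero    f≗g = refl
∑-cong (suc n) f≗g = cong₂ _+_ (∑-cong n f≗g) (f≗g (+ n))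

∑-distrib-+ : ∀ n f g → ∑ n (λ i → f i + g i) ≡ ∑ n f + ∑ n g
∑-distrib-+ zero    f g = refl
∑-distrib-+ (suc n) f g = trans (cong (_+ (f (+ n) + g (+ n))) (∑-distrib-+ n f g))
  (rearrange (∑ n f) (∑ n g) (f (+ n)) (g (+ n)))
  where
  rearrange : ∀ a b c d → (a + b) + (c + d) ≡ (a + c) + (b + d)
  rearrange = solve-∀

*-distribˡ-∑ : ∀ n a f → ∑ n (λ i → a * f i) ≡ a * ∑ n f
*-distribˡ-∑ zero    a f = sym (ℤ.*-zeroʳ a)
*-distribˡ-∑ (suc n) a f = trans (cong (_+ a * f (+ n)) (*-distribˡ-∑ n a f))
  (sym (ℤ.*-distribˡ-+ a (∑ n f) (f (+ n))))

*-distribʳ-∑ : ∀ n a f → ∑ n (λ i → f i * a) ≡ ∑ n f * a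
*-distribʳ-∑ n a f = trans (∑-cong n (λ i → ℤ.*-comm (f i) a))
  (trans (*-distribˡ-∑ n a f) (ℤ.*-comm a (∑ n f)))

∑-distrib-- : ∀ n f g → ∑ n (λ i → f i - g i) ≡ ∑ n f - ∑ n g
∑-distrib-- n f g = trans (∑-distrib-+ n f (λ i → - g i)) (cong (_+_ (∑ n f))
  (trans (∑-cong n (λ i → sym (ℤ.-1*i≡-i (g i))))
    (trans (*-distribˡ-∑ n ℤ.-1ℤ g) (ℤ.-1*i≡-i (∑ n g)))))

∑-zero : ∀ n → ∑ n (λ _ → 0ℤ) ≡ 0ℤ
∑-zero zero    = refl
∑-zero (suc n) = trans (ℤ.+-identityʳ _) (∑-zero n)

∑-mono-≤ : ∀ n {f g} → (∀ x → f x ℤ.≤ g x) → ∑ n f ℤ.≤ ∑ n g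
∑-mono-≤ zero    f≤g = ℤ.≤-refl
∑-mono-≤ (suc n) f≤g = ℤ.+-mono-≤ (∑-mono-≤ n f≤g) (f≤g (+ n))

∑-nonNeg : ∀ n {f} → (∀ x → 0ℤ ℤ.≤ f x) → 0ℤ ℤ.≤ ∑ n f
∑-nonNeg n {f} 0≤f = subst (ℤ._≤ ∑ n f) (∑-zero n) (∑-mono-≤ n 0≤f)

term≤∑ : ∀ n {f} → (∀ x → 0ℤ ℤ.≤ f x) → ∀ i → i < n → f (+ i) ℤ.≤ ∑ n f
term≤∑ (suc n) {f} 0≤f i i<1+n with ℕ.m≤n⇒m<n∨m≡n (ℕ.≤-pred i<1+n)
... | inj₁ i<n  = subst (ℤ._≤ ∑ n f + f (+ n)) (ℤ.+-identityʳ _)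
  (ℤ.+-mono-≤ (term≤∑ n 0≤f i i<n) (0≤f (+ n)))
... | inj₂ refl = subst (ℤ._≤ ∑ n f + f (+ n)) (ℤ.+-identityˡ _)
  (ℤ.+-mono-≤ (∑-nonNeg n 0≤f) ℤ.≤-refl)

∑-∣ : ∀ {d} n {f} → (∀ x → d ∣ f x) → d ∣ ∑ n f
∑-∣ zero    d∣f = divides 0ℤ refl
∑-∣ (suc n) d∣f = ∣m∣n⇒∣m+n (∑-∣ n d∣f) (d∣f (+ n))

Periodic : ℕ → (ℤ → ℤ) → Set
Periodic n f = ∀ x → f (x + + n) ≡ f x

periodic-*ℕ : ∀ {n f} → Periodic n f → ∀ k x → f (x + + k * + n) ≡ f x
periodic-*ℕ {n} {f} per zero x = cong f (trans (cong (_+_ x) (ℤ.*-zeroˡ (+ n))) (ℤ.+-identityʳ x))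
periodic-*ℕ {n} {f} per (suc k) x = begin
  f (x + + suc k * + n)     ≡⟨ cong f (rearrange x (+ k) (+ n)) ⟩
  f (x + + k * + n + + n)   ≡⟨ per _ ⟩
  f (x + + k * + n)         ≡⟨ periodic-*ℕ per k x ⟩
  f x                       ∎
  where
  rearrange : ∀ x k n → x + (1ℤ + k) * n ≡ x + k * n + n
  rearrange = solve-∀

periodic-* : ∀ {n f} → Periodic n f → ∀ q x → f (x + q * + n) ≡ f x
periodic-* per (+ k) x = periodic-*ℕ per k x
periodic-* {n} {f} per q@(-[1+ k ]) x = begin
  f (x + q * + n)                      ≡⟨ sym (periodic-*ℕ per (suc k) _) ⟩
  f (x + q * + n + (- q) * + n)        ≡⟨ cong f (rearrange x q (+ n)) ⟩
  f x                                  ∎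
  where
  rearrange : ∀ x q n → x + q * n + (- q) * n ≡ x
  rearrange = solve-∀

periodic-∣ : ∀ {n f} → Periodic n f → ∀ {x y} → + n ∣ x - y → f x ≡ f y
periodic-∣ {n} {f} per {x} {y} (divides q x-y≡q*n) = trans (cong f x≡y+q*n) (periodic-* per q y)
  where
  rearrange : ∀ x y → x ≡ y + (x - y)
  rearrange = solve-∀
  x≡y+q*n : x ≡ y + q * + n
  x≡y+q*n = trans (rearrange x y) (cong (_+_ y) x-y≡q*n)

periodic-neg : ∀ {n f} → Periodic n f → Periodic n (λ x → f (- x))
periodic-neg {n} {f} per x = periodic-∣ per (divides ℤ.-1ℤ (rearrange x (+ n)))
  where
  rearrange : ∀ x n → - (x + n) - - x ≡ ℤ.-1ℤ * n
  rearrange = solve-∀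

periodic-reflect : ∀ {n f} → Periodic n f → ∀ x → Periodic n (λ i → f (x - i))
periodic-reflect {n} {f} per x i = periodic-∣ {f = f} per {x - (i + + n)} {x - i} (divides ℤ.-1ℤ (rearrange x i (+ n)))
  where
  rearrange : ∀ x i n → (x - (i + n)) - (x - i) ≡ ℤ.-1ℤ * n
  rearrange = solve-∀

-- Both sides are the sum over `0, …, n`, with the first or the last term split off. If `f` has
-- period `n`, the end terms cancel and the shift by one remains.
∑-shift-1 : ∀ n f → ∑ n (λ i → f (1ℤ + i)) + f 0ℤ ≡ ∑ n f + f (+ n)
∑-shift-1 zero    f = refl
∑-shift-1 (suc n) f = begin
  (∑ n (λ i → f (1ℤ + i)) + f (+ suc n)) + f 0ℤ  ≡⟨ rearrange (∑ n (λ i → f (1ℤ + i))) _ _ ⟩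
  (∑ n (λ i → f (1ℤ + i)) + f 0ℤ) + f (+ suc n)  ≡⟨ cong (_+ f (+ suc n)) (∑-shift-1 n f) ⟩
  ∑ n f + f (+ n) + f (+ suc n)                  ∎
  where
  rearrange : ∀ a b c → (a + b) + c ≡ (a + c) + b
  rearrange = solve-∀

∑-shiftℕ : ∀ {n f} → Periodic n f → ∀ k → ∑ n (λ i → f (+ k + i)) ≡ ∑ n f
∑-shiftℕ {n} {f} per zero    = ∑-cong n (λ i → cong f (ℤ.+-identityˡ i))
∑-shiftℕ {n} {f} per (suc k) = begin
  ∑ n (λ i → f (+ suc k + i))     ≡⟨ ∑-cong n (λ i → cong f (rearrange (+ k) i)) ⟩
  ∑ n (λ i → g (1ℤ + i))          ≡⟨ ∙-cancelʳ (g 0ℤ) (∑ n (λ i → g (1ℤ + i))) (∑ n g)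
      (trans (∑-shift-1 n g) (cong (_+_ (∑ n g)) g-n≡g-0)) ⟩
  ∑ n g                           ≡⟨ ∑-shiftℕ per k ⟩
  ∑ n f                           ∎
  where
  g : ℤ → ℤ
  g i = f (+ k + i)
  g-n≡g-0 : g (+ n) ≡ g 0ℤ
  g-n≡g-0 = trans (per (+ k)) (cong f (sym (ℤ.+-identityʳ (+ k))))
  rearrange : ∀ k i → (1ℤ + k) + i ≡ k + (1ℤ + i)
  rearrange = solve-∀

∑-shift : ∀ {n f} → Periodic n f → ∀ a → ∑ n (λ i → f (a + i)) ≡ ∑ n f
∑-shift per (+ k) = ∑-shiftℕ per k
∑-shift {n} {f} per a@(-[1+ k ]) = begin
  -- A negative shift is undone by the natural shift `suc k` of the function already shifted.
  ∑ n g                            ≡⟨ sym (∑-shiftℕ g-per (suc k)) ⟩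
  ∑ n (λ i → f (a + (- a + i)))    ≡⟨ ∑-cong n (λ i → cong f (rearrange a i)) ⟩
  ∑ n f                            ∎
  where
  g : ℤ → ℤ
  g i = f (a + i)
  g-per : Periodic n g
  g-per x = trans (cong f (sym (ℤ.+-assoc a x (+ n)))) (per (a + x))
  rearrange : ∀ a i → a + (- a + i) ≡ i
  rearrange = solve-∀

∑-reverse : ∀ n f → ∑ n (λ i → f (+ n - (1ℤ + i))) ≡ ∑ n f
∑-reverse zero    f = refl
∑-reverse (suc n) f = begin
  ∑ n (λ i → f (+ suc n - (1ℤ + i))) + f (+ suc n - + suc n)
    ≡⟨ cong₂ _+_ (∑-cong n (λ i → cong f (rearrange (+ n) i))) (cong f (ℤ.+-inverseʳ (+ suc n))) ⟩
  ∑ n (λ i → f (1ℤ + (+ n - (1ℤ + i)))) + f 0ℤ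
    ≡⟨ cong (_+ f 0ℤ) (∑-reverse n (λ i → f (1ℤ + i))) ⟩
  ∑ n (λ i → f (1ℤ + i)) + f 0ℤ
    ≡⟨ ∑-shift-1 n f ⟩
  ∑ n f + f (+ n) ∎
  where
  rearrange : ∀ n i → (1ℤ + n) - (1ℤ + i) ≡ 1ℤ + (n - (1ℤ + i))
  rearrange = solve-∀

-- The index `- i` leaves the range of summation, but after a shift by `1 - n` it becomes
-- `n - 1 - i`, which only reverses the range.
∑-reflect : ∀ {n f} → Periodic n f → ∑ n (λ i → f (- i)) ≡ ∑ n f
∑-reflect {n} {f} per = begin
  ∑ n (λ i → f (- i))                        ≡⟨ sym (∑-shift (periodic-neg per) (1ℤ - + n)) ⟩
  ∑ n (λ i → f (- ((1ℤ - + n) + i)))         ≡⟨ ∑-cong n (λ i → cong f (rearrange (+ n) i)) ⟩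
  ∑ n (λ i → f (+ n - (1ℤ + i)))             ≡⟨ ∑-reverse n f ⟩
  ∑ n f                                      ∎
  where
  rearrange : ∀ n i → - ((1ℤ - n) + i) ≡ n - (1ℤ + i)
  rearrange = solve-∀

∑-reflect-shift : ∀ {n f} → Periodic n f → ∀ a → ∑ n (λ i → f (a - i)) ≡ ∑ n f
∑-reflect-shift {n} {f} per a = trans (∑-reflect {n} {λ i → f (a + i)} g-per) (∑-shift per a)
  where
  g-per : Periodic n (λ i → f (a + i))
  g-per x = trans (cong f (sym (ℤ.+-assoc a x (+ n)))) (per (a + x))

∑-+-split : ∀ m n f → ∑ (m ℕ.+ n) f ≡ ∑ n f + ∑ m (λ i → f (i + + n))
∑-+-split zero    n f = sym (ℤ.+-identityʳ _)
∑-+-split (suc m) n f = trans (cong (_+ f (+ (m ℕ.+ n))) (∑-+-split m n f)) (ℤ.+-assoc (∑ n f) _ _)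

∑-blocks : ∀ {m f} → Periodic m f → ∀ k → ∑ (k ℕ.* m) f ≡ + k * ∑ m f
∑-blocks {m} {f} per zero    = sym (ℤ.*-zeroˡ (∑ m f))
∑-blocks {m} {f} per (suc k) = begin
  ∑ (m ℕ.+ k ℕ.* m) f                              ≡⟨ ∑-+-split m (k ℕ.* m) f ⟩
  ∑ (k ℕ.* m) f + ∑ m (λ i → f (i + + (k ℕ.* m)))  ≡⟨ cong₂ _+_ (∑-blocks per k) (∑-cong m (λ i →
      trans (cong (λ z → f (i + z)) (ℤ.pos-* k m)) (periodic-* per (+ k) i))) ⟩
  + k * ∑ m f + ∑ m f                              ≡⟨ rearrange (+ k) (∑ m f) ⟩
  + suc k * ∑ m f                                  ∎
  where
  rearrange : ∀ k s → k * s + s ≡ (1ℤ + k) * s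
  rearrange = solve-∀

periodic-ext : ∀ n .{{_ : NonZero n}} {f g} → Periodic n f → Periodic n g →
  (∀ i → i < n → f (+ i) ≡ g (+ i)) → ∀ x → f x ≡ g x
periodic-ext n {f} {g} perf perg f≗g x = begin
  f x             ≡⟨ periodic-∣ perf n∣x-r ⟩
  f (+ (x %ℕ n))  ≡⟨ f≗g _ (n%ℕd<d x n) ⟩
  g (+ (x %ℕ n))  ≡⟨ sym (periodic-∣ perg n∣x-r) ⟩
  g x             ∎
  where
  rearrange : ∀ r q → (r + q) - r ≡ q
  rearrange = solve-∀
  n∣x-r : + n ∣ x - + (x %ℕ n)
  n∣x-r = divides (x /ℕ n) (trans (cong (_- + (x %ℕ n)) (a≡a%ℕn+[a/ℕn]*n x n)) (rearrange (+ (x %ℕ n)) _))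

∑≡0⇒≡0 : ∀ n .{{_ : NonZero n}} {f} → Periodic n f → (∀ x → 0ℤ ℤ.≤ f x) → ∑ n f ≡ 0ℤ → ∀ x → f x ≡ 0ℤ
∑≡0⇒≡0 n {f} per 0≤f ∑≡0 = periodic-ext n per (λ _ → refl) (λ i i<n →
  ℤ.≤-antisym (subst (f (+ i) ℤ.≤_) ∑≡0 (term≤∑ n 0≤f i i<n)) (0≤f (+ i)))

-- Over ℤ_n this is the identity of the group ring; over ℤ_k with `k` a multiple of `n` it is the
-- indicator of the subgroup generated by `n`.
δ : ℕ → ℤ → ℤ
δ n x = ind ⌊ + n ∣? x ⌋

δ-∣ : ∀ {n x} → + n ∣ x → δ n x ≡ 1ℤ
δ-∣ {n} {x} n∣x with + n ∣? x
... | yes _  = refl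
... | no n∤x = contradiction n∣x n∤x

δ-∤ : ∀ {n x} → ¬ (+ n ∣ x) → δ n x ≡ 0ℤ
δ-∤ {n} {x} n∤x with + n ∣? x
... | yes n∣x = contradiction n∣x n∤x
... | no _    = refl

δ-nonNeg : ∀ n x → 0ℤ ℤ.≤ δ n x
δ-nonNeg n x with + n ∣? x
... | yes _ = +≤+ z≤n
... | no _  = +≤+ z≤n

δ-iff : ∀ {m n x y} → (+ m ∣ x → + n ∣ y) → (+ n ∣ y → + m ∣ x) → δ m x ≡ δ n y
δ-iff {m} {n} {x} {y} to from with + m ∣? x
... | yes m∣x = sym (δ-∣ (to m∣x))
... | no m∤x  = sym (δ-∤ (λ n∣y → m∤x (from n∣y)))

δ-periodic : ∀ n → Periodic n (δ n)
δ-periodic n x = δ-iff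
  (λ d → subst (+ n ∣_) (rearrange x (+ n)) (∣m∣n⇒∣m-n d ∣-refl))
  (λ d → ∣m∣n⇒∣m+n d ∣-refl)
  where
  rearrange : ∀ x n → (x + n) - n ≡ x
  rearrange = solve-∀

∑-δ : ∀ n .{{_ : NonZero n}} → ∑ n (δ n) ≡ 1ℤ
∑-δ (suc k) = prefix k ℕ.≤-refl
  where
  -- The modulus stays `suc k` while the range grows; every index after 0 is positive and below the
  -- modulus.
  prefix : ∀ j → j ℕ.≤ k → ∑ (suc j) (δ (suc k)) ≡ 1ℤ
  prefix zero    _   = trans (ℤ.+-identityˡ _) (δ-∣ {suc k} (divides 0ℤ refl))
  prefix (suc j) j<k = cong₂ _+_ (prefix j (ℕ.<⇒≤ j<k))
    (δ-∤ (λ d → ℕ.>⇒∤ (s≤s j<k) (∣⇒∣ᵤ d)))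

-- Where `δ n (x - i)` does not vanish, periodicity gives `f i ≡ f x`; so `f x` factors out and the
-- remaining weight is 1.
∑-*-δ : ∀ n .{{_ : NonZero n}} {f} → Periodic n f → ∀ x → ∑ n (λ i → f i * δ n (x - i)) ≡ f x
∑-*-δ n {f} per x = begin
  ∑ n (λ i → f i * δ n (x - i))  ≡⟨ ∑-cong n fi≡fx ⟩
  ∑ n (λ i → f x * δ n (x - i))  ≡⟨ *-distribˡ-∑ n (f x) (λ i → δ n (x - i)) ⟩
  f x * ∑ n (λ i → δ n (x - i))  ≡⟨ cong (f x *_) (trans (∑-reflect-shift (δ-periodic n) x) (∑-δ n)) ⟩
  f x * 1ℤ                       ≡⟨ ℤ.*-identityʳ (f x) ⟩
  f x                            ∎
  where
  fi≡fx : ∀ i → f i * δ n (x - i) ≡ f x * δ n (x - i)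
  fi≡fx i with + n ∣? (x - i)
  ... | yes d = cong (_* 1ℤ) (sym (periodic-∣ per d))
  ... | no _  = trans (ℤ.*-zeroʳ (f i)) (sym (ℤ.*-zeroʳ (f x)))

-- Additive operators and the Frobenius congruence

-- With composition as product these form a semiring, where powers of a group ring element make
-- sense and the freshman's dream applies. Equality is pointwise, hence `resp`; `add` and `zer`
-- provide distributivity over a sum on the right and `A * 0# ≈ 0#`.
record AdditiveOperator : Set where
  field
    ap   : (ℤ → ℤ) → ℤ → ℤ
    resp : ∀ {f g} → (∀ x → f x ≡ g x) → ∀ x → ap f x ≡ ap g x
    add  : ∀ f g x → ap (λ y → f y + g y) x ≡ ap f x + ap g x
    zer  : ∀ x → ap (λ _ → 0ℤ) x ≡ 0ℤ

open AdditiveOperator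

operatorSemiring : Semiring 0ℓ 0ℓ
operatorSemiring = record
  { Carrier = AdditiveOperator
  ; _≈_ = λ A B → ∀ f x → ap A f x ≡ ap B f x
  ; _+_ = λ A B → record
    { ap   = λ f x → ap A f x + ap B f x
    ; resp = λ f≗g x → cong₂ _+_ (resp A f≗g x) (resp B f≗g x)
    ; add  = λ f g x → trans (cong₂ _+_ (add A f g x) (add B f g x)) (interchange (ap A f x) (ap A g x) _ _)
    ; zer  = λ x → cong₂ _+_ (zer A x) (zer B x)
    }
  ; _*_ = λ A B → record
    { ap   = λ f x → ap A (ap B f) x
    ; resp = λ f≗g x → resp A (resp B f≗g) x
    ; add  = λ f g x → trans (resp A (add B f g) x) (add A (ap B f) (ap B g) x)
    ; zer  = λ x → trans (resp A (zer B) x) (zer A x)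
    }
  ; 0# = record { ap = λ _ _ → 0ℤ ; resp = λ _ _ → refl ; add = λ _ _ _ → refl ; zer = λ _ → refl }
  ; 1# = record { ap = λ f → f ; resp = λ f≗g → f≗g ; add = λ _ _ _ → refl ; zer = λ _ → refl }
  ; isSemiring = record
    { isSemiringWithoutAnnihilatingZero = record
      { +-isCommutativeMonoid = record
        { isMonoid = record
          { isSemigroup = record
            { isMagma = record
              { isEquivalence = record
                { refl  = λ _ _ → refl
                ; sym   = λ A≈B f x → sym (A≈B f x)
                ; trans = λ A≈B B≈B′ f x → trans (A≈B f x) (B≈B′ f x)
                }
              ; ∙-cong = λ A≈A′ B≈B′ f x → cong₂ _+_ (A≈A′ f x) (B≈B′ f x)
              }
            ; assoc = λ A B A′ f x → ℤ.+-assoc (ap A f x) (ap B f x) (ap A′ f x)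
            }
          ; identity = (λ A f x → ℤ.+-identityˡ (ap A f x)) , (λ A f x → ℤ.+-identityʳ (ap A f x))
          }
        ; comm = λ A B f x → ℤ.+-comm (ap A f x) (ap B f x)
        }
      ; *-cong = λ {A} {A′} {B} {B′} A≈A′ B≈B′ f x → trans (resp A (B≈B′ f) x) (A≈A′ (ap B′ f) x)
      ; *-assoc = λ _ _ _ _ _ → refl
      ; *-identity = (λ _ _ _ → refl) , (λ _ _ _ → refl)
      ; distrib = (λ A B B′ f x → add A (ap B f) (ap B′ f) x) , (λ _ _ _ _ _ → refl)
      }
    ; zero = (λ _ _ _ → refl) , (λ A _ x → zer A x)
    }
  }
  where
  interchange : ∀ a b c d → (a + b) + (c + d) ≡ (a + c) + (b + d)
  interchange = solve-∀

private
  module Op = Semiring operatorSemiring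
  module OpExp = Algebra.Properties.Semiring.Exp operatorSemiring
  module OpMult = Algebra.Properties.Semiring.Mult operatorSemiring
  module ℤMult = Algebra.Properties.Semiring.Mult ℤ.+-*-semiring

ap-× : ∀ n A f x → ap (n OpMult.× A) f x ≡ + n * ap A f x
ap-× zero    A f x = sym (ℤ.*-zeroˡ (ap A f x))
ap-× (suc n) A f x = trans (cong (_+_ (ap A f x)) (ap-× n A f x)) (rearrange (+ n) (ap A f x))
  where
  rearrange : ∀ n a → a + n * a ≡ (1ℤ + n) * a
  rearrange = solve-∀

×≡* : ∀ n a → n ℤMult.× a ≡ + n * a
×≡* zero    a = sym (ℤ.*-zeroˡ a)
×≡* (suc n) a = trans (cong (_+_ a) (×≡* n a)) (rearrange (+ n) a)
  where
  rearrange : ∀ n a → a + n * a ≡ (1ℤ + n) * a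
  rearrange = solve-∀

1^n≡1 : ∀ n → 1ℤ ^ᶻ n ≡ 1ℤ
1^n≡1 zero    = refl
1^n≡1 (suc n) = trans (ℤ.*-identityˡ _) (1^n≡1 n)

-- Induction on `n`, with the freshman's dream applied to `1 + n`.
fermat : ∀ {p} → Prime p → ∀ n → + p ∣ (+ n) ^ᶻ p - + n
fermat {suc q} pr zero = divides 0ℤ refl
fermat {p} pr (suc n) with FreshmansDream.freshmansDream ℤ.+-*-semiring pr 1ℤ (+ n) (ℤ.*-comm 1ℤ (+ n))
... | r , [1+n]^p≡ = subst (+ p ∣_) (sym eq) (∣m∣n⇒∣m+n (fermat pr n) (divides r (ℤ.*-comm (+ p) r)))
  where
  rearrange : ∀ a n b → ((1ℤ + a) + b) - (1ℤ + n) ≡ (a - n) + b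
  rearrange = solve-∀
  eq : (+ suc n) ^ᶻ p - + suc n ≡ ((+ n) ^ᶻ p - + n) + + p * r
  eq = trans (cong (_- + suc n) (trans [1+n]^p≡
         (cong₂ (λ u v → (u + (+ n) ^ᶻ p) + v) (1^n≡1 p) (×≡* p r))))
       (rearrange ((+ n) ^ᶻ p) (+ n) (+ p * r))

-- f ↦ g ∗ f, where only the values of g on {0,…,n−1} enter.
convolution : (ℤ → ℤ) → ℕ → AdditiveOperator
convolution g n = record
  { ap   = λ f x → ∑ n (λ i → g i * f (x - i))
  ; resp = λ f≗g x → ∑-cong n (λ i → cong (g i *_) (f≗g (x - i)))
  ; add  = λ f h x → trans (∑-cong n (λ i → ℤ.*-distribˡ-+ (g i) (f (x - i)) (h (x - i))))
      (∑-distrib-+ n (λ i → g i * f (x - i)) (λ i → g i * h (x - i)))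
  ; zer  = λ x → trans (∑-cong n (λ i → ℤ.*-zeroʳ (g i))) (∑-zero n)
  }

-- Multiplication by the monomial `a [k]`. Passing from `convolution g n` to `convolution g (suc n)`
-- adds the monomial with `a = g n` and `k = n`.
scaledShift : ℤ → ℤ → AdditiveOperator
scaledShift a k = record
  { ap   = λ f x → a * f (x - k)
  ; resp = λ f≗g x → cong (a *_) (f≗g (x - k))
  ; add  = λ f g x → ℤ.*-distribˡ-+ a (f (x - k)) (g (x - k))
  ; zer  = λ _ → ℤ.*-zeroʳ a
  }

convolution-scaledShift-comm : ∀ g n a k →
  (convolution g n Op.* scaledShift a k) Op.≈ (scaledShift a k Op.* convolution g n)
convolution-scaledShift-comm g n a k f x = trans
  (∑-cong n (λ i → trans (swap (g i) a _) (cong (λ y → a * (g i * f y)) (shift x i k))))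
  (*-distribˡ-∑ n a (λ i → g i * f (x - k - i)))
  where
  swap : ∀ u v w → u * (v * w) ≡ v * (u * w)
  swap = solve-∀
  shift : ∀ x i k → x - i - k ≡ x - k - i
  shift = solve-∀

scaledShift-^ : ∀ a k j f x → ap (scaledShift a k OpExp.^ j) f x ≡ a ^ᶻ j * f (x - + j * k)
scaledShift-^ a k zero    f x = trans (cong f (unit x k)) (sym (ℤ.*-identityˡ _))
  where
  unit : ∀ x k → x ≡ x - 0ℤ * k
  unit = solve-∀
scaledShift-^ a k (suc j) f x = trans (cong (a *_) (scaledShift-^ a k j f (x - k)))
  (trans (sym (ℤ.*-assoc a (a ^ᶻ j) _)) (cong (λ y → a * a ^ᶻ j * f y) (shift x k (+ j))))
  where
  shift : ∀ x k j → (x - k) - j * k ≡ x - (1ℤ + j) * k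
  shift = solve-∀

-- That is, `g^p ≡ Σ g(i) [p i]` modulo `p` in the group ring. By induction on `n`: the freshman's
-- dream splits off the last monomial, whose `p`-th power `g(n)^p [p n]` is congruent to
-- `g(n) [p n]`.
convolution-frobenius : ∀ {p} → Prime p → ∀ g → (∀ i → + p ∣ g i ^ᶻ p - g i) → ∀ n f x →
  + p ∣ ap (convolution g n OpExp.^ p) f x - ∑ n (λ i → g i * f (x - + p * i))
convolution-frobenius {suc q} pr g g^p≡g zero    f x = divides 0ℤ refl
convolution-frobenius {p} pr g g^p≡g (suc n) f x
  with FreshmansDream.freshmansDream operatorSemiring pr
         (convolution g n) (scaledShift (g (+ n)) (+ n)) (convolution-scaledShift-comm g n (g (+ n)) (+ n))
... | r , dream = subst (+ p ∣_) (sym eq) (∣m∣n⇒∣m+n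
    (∣m∣n⇒∣m+n (convolution-frobenius pr g g^p≡g n f x) (∣m⇒∣m*n y (g^p≡g (+ n))))
    (divides (ap r f x) (ℤ.*-comm (+ p) (ap r f x))))
  where
  y = f (x - + p * + n)
  s = ∑ n (λ i → g i * f (x - + p * i))
  T = ap (convolution g n OpExp.^ p) f x
  rearrange : ∀ T gp y b s g → ((T + gp * y) + b) - (s + g * y) ≡ ((T - s) + (gp - g) * y) + b
  rearrange = solve-∀
  eq : ap (convolution g (suc n) OpExp.^ p) f x - (s + g (+ n) * y)
       ≡ ((T - s) + (g (+ n) ^ᶻ p - g (+ n)) * y) + + p * ap r f x
  eq = trans (cong (_- (s + g (+ n) * y)) (trans (trans (OpExp.^-congˡ p (λ _ _ → refl) f x) (dream f x))
         (cong₂ (λ u v → (T + u) + v) (scaledShift-^ (g (+ n)) (+ n) p f x) (ap-× p r f x))))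
       (rearrange T (g (+ n) ^ᶻ p) y (+ p * ap r f x) s (g (+ n)))

-- The group ring equation

0≤i² : ∀ i → 0ℤ ℤ.≤ i * i
0≤i² (+ n)        = subst (0ℤ ℤ.≤_) (ℤ.pos-* n n) (+≤+ z≤n)
0≤i² ℤ.-[1+ n ]   = +≤+ z≤n

i²≡0⇒i≡0 : ∀ i → i * i ≡ 0ℤ → i ≡ 0ℤ
i²≡0⇒i≡0 i i²≡0 = [ (λ eq → eq) , (λ eq → eq) ]′ (ℤ.i*j≡0⇒i≡0∨j≡0 i i²≡0)

∣∧abs<⇒≡0 : ∀ {p i} → + p ∣ i → ∣ i ∣ < p → i ≡ 0ℤ
∣∧abs<⇒≡0 {p} {i} p∣i ∣i∣<p with ∣ i ∣ in eq | ∣⇒∣ᵤ p∣i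
... | zero  | _   = ℤ.∣i∣≡0⇒i≡0 eq
... | suc k | p∣k = contradiction p∣k (ℕ.>⇒∤ ∣i∣<p)

ℤ-euclidsLemma : ∀ {p} → Prime p → ∀ a b → + p ∣ a * b → (+ p ∣ a) ⊎ (+ p ∣ b)
ℤ-euclidsLemma {p} pr a b p∣ab with euclidsLemma ∣ a ∣ ∣ b ∣ pr (subst (p ℕ.∣_) (ℤ.abs-* a b) (∣⇒∣ᵤ p∣ab))
... | inj₁ p∣a = inj₁ (∣ᵤ⇒∣ p∣a)
... | inj₂ p∣b = inj₂ (∣ᵤ⇒∣ p∣b)

p∣a^n⇒p∣a : ∀ {p} → Prime p → ∀ a n → + p ∣ a ^ᶻ n → + p ∣ a
-- A divisor of 1 divides everything.
p∣a^n⇒p∣a pr a zero    p∣1 = ∣-trans p∣1 (divides a (sym (ℤ.*-identityʳ a)))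
p∣a^n⇒p∣a pr a (suc n) p∣a*a^n = [ (λ d → d) , p∣a^n⇒p∣a pr a n ]′ (ℤ-euclidsLemma pr a (a ^ᶻ n) p∣a*a^n)

Binary : (ℤ → ℤ) → Set
Binary f = ∀ x → f x ≡ 0ℤ ⊎ f x ≡ 1ℤ

binary-nonNeg : ∀ {f} → Binary f → ∀ x → 0ℤ ℤ.≤ f x
binary-nonNeg bin x with bin x
... | inj₁ eq = ℤ.≤-reflexive (sym eq)
... | inj₂ eq = subst (0ℤ ℤ.≤_) (sym eq) (+≤+ z≤n)

symmetrize : (ℤ → ℤ) → ℤ → ℤ
symmetrize X x = X x + X (- x)

symmetrize-even : ∀ X x → symmetrize X (- x) ≡ symmetrize X x
symmetrize-even X x = trans (cong (λ z → X (- x) + X z) (ℤ.neg-involutive x)) (ℤ.+-comm (X (- x)) (X x))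

symmetrize-periodic : ∀ {n X} → Periodic n X → Periodic n (symmetrize X)
symmetrize-periodic per x = cong₂ _+_ (per x) (periodic-neg per x)

-- X is the indicator function of the set X ⊆ ℤ_n and the equation is X(X + X⁽⁻¹⁾) = aG − cX
-- in the group ring of G = ℤ_n.
record Solution (n : ℕ) (X : ℤ → ℤ) (a c : ℤ) : Set where
  field
    periodic : Periodic n X
    binary   : Binary X
    X0≡0     : X 0ℤ ≡ 0ℤ
    equation : ∀ x → ∑ n (λ i → X i * symmetrize X (x - i)) ≡ a - c * X x
    0<a      : 0ℤ ℤ.< a
    a<2∣X∣   : a ℤ.< + 2 * ∑ n X

module SolutionProperties {n : ℕ} .{{_ : NonZero n}} {X : ℤ → ℤ} {a c : ℤ} (sol : Solution n X a c) where
  open Solution sol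

  Y : ℤ → ℤ
  Y = symmetrize X

  Y0≡0 : Y 0ℤ ≡ 0ℤ
  Y0≡0 = cong₂ _+_ X0≡0 X0≡0

  Y-even : ∀ x → Y (- x) ≡ Y x
  Y-even = symmetrize-even X

  Y-periodic : Periodic n Y
  Y-periodic = symmetrize-periodic periodic

  Y-values : ∀ x → ∃[ k ] (k ≤ 2 × Y x ≡ + k)
  Y-values x with binary x | binary (- x)
  ... | inj₁ h | inj₁ h′ = 0 , z≤n , cong₂ _+_ h h′
  ... | inj₁ h | inj₂ h′ = 1 , s≤s z≤n , cong₂ _+_ h h′
  ... | inj₂ h | inj₁ h′ = 1 , s≤s z≤n , cong₂ _+_ h h′
  ... | inj₂ h | inj₂ h′ = 2 , ℕ.≤-refl , cong₂ _+_ h h′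

  -- As `X` takes no negative values, `Y = 0` forces `X = 0`, and the two bounds on `a` become
  -- `0 < a < 0`.
  Y≡0⇒⊥ : ¬ (∀ x → Y x ≡ 0ℤ)
  Y≡0⇒⊥ Y≡0 = ℤ.<-irrefl refl (ℤ.<-trans 0<a (subst (λ s → a ℤ.< + 2 * s) ∑X≡0 a<2∣X∣))
    where
    X≡0 : ∀ x → X x ≡ 0ℤ
    X≡0 x with binary x | binary (- x)
    ... | inj₁ h | _       = h
    ... | inj₂ h | inj₁ h′ = contradiction (trans (sym (cong₂ _+_ h h′)) (Y≡0 x)) (λ ())
    ... | inj₂ h | inj₂ h′ = contradiction (trans (sym (cong₂ _+_ h h′)) (Y≡0 x)) (λ ())
    ∑X≡0 : ∑ n X ≡ 0ℤ
    ∑X≡0 = trans (∑-cong n X≡0) (∑-zero n)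

  -- The part `X ∗ Y` is the equation at `x`. In the part from `X⁽⁻¹⁾`, reflecting the index and
  -- using that `Y` is even gives the equation at `- x`.
  Y∗Y : ∀ x → ∑ n (λ i → Y i * Y (x - i)) ≡ + 2 * a - c * Y x
  Y∗Y x = begin
    ∑ n (λ i → Y i * Y (x - i))
      ≡⟨ ∑-cong n (λ i → ℤ.*-distribʳ-+ (Y (x - i)) (X i) (X (- i))) ⟩
    ∑ n (λ i → X i * Y (x - i) + X (- i) * Y (x - i))
      ≡⟨ ∑-distrib-+ n _ _ ⟩
    ∑ n (λ i → X i * Y (x - i)) + ∑ n (λ i → h (- i))
      ≡⟨ cong₂ _+_ (equation x) (trans (∑-reflect h-periodic) (∑-cong n h-even)) ⟩
    (a - c * X x) + ∑ n (λ i → X i * Y (- x - i))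
      ≡⟨ cong (_+_ (a - c * X x)) (equation (- x)) ⟩
    (a - c * X x) + (a - c * X (- x))
      ≡⟨ rearrange a c (X x) (X (- x)) ⟩
    + 2 * a - c * Y x ∎
    where
    h : ℤ → ℤ
    h i = X i * Y (x + i)
    h-periodic : Periodic n h
    h-periodic i = cong₂ _*_ (periodic i) (trans (cong Y (sym (ℤ.+-assoc x i (+ n)))) (Y-periodic (x + i)))
    h-even : ∀ i → h i ≡ X i * Y (- x - i)
    h-even i = cong (X i *_) (trans (sym (Y-even (x + i))) (cong Y (ℤ.neg-distrib-+ x i)))
    rearrange : ∀ a c u v → (a - c * u) + (a - c * v) ≡ + 2 * a - c * (u + v)
    rearrange = solve-∀

  -- Σ (Y(i) − Y(g+i))² = 2 c (Y(g) − Y(0)).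
  Y-shift-invariant : ∀ g → c * Y g ≡ 0ℤ → ∀ x → Y (x + g) ≡ Y x
  Y-shift-invariant g cYg≡0 x = trans (cong Y (ℤ.+-comm x g)) (sym (ℤ.i-j≡0⇒i≡j (Y x) (Y (g + x))
    (i²≡0⇒i≡0 _ (∑≡0⇒≡0 n {λ i → (Y i - Y (g + i)) * (Y i - Y (g + i))}
      (λ i → cong (λ d → d * d) (cong₂ _-_ (Y-periodic i) (Yg-periodic i)))
      (λ i → 0≤i² (Y i - Y (g + i))) ∑≡0 x))))
    where
    Yg-periodic : Periodic n (λ i → Y (g + i))
    Yg-periodic i = trans (cong Y (sym (ℤ.+-assoc g i (+ n)))) (Y-periodic (g + i))
    expand : ∀ u v → (u - v) * (u - v) ≡ (u * u + v * v) - + 2 * (u * v)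
    expand = solve-∀
    ∑Y² : ∑ n (λ i → Y i * Y i) ≡ + 2 * a
    ∑Y² = begin
      ∑ n (λ i → Y i * Y i)          ≡⟨ ∑-cong n (λ i → cong (Y i *_) (trans (sym (Y-even i)) (cong Y (sym (ℤ.+-identityˡ (- i)))))) ⟩
      ∑ n (λ i → Y i * Y (0ℤ - i))   ≡⟨ Y∗Y 0ℤ ⟩
      + 2 * a - c * Y 0ℤ             ≡⟨ cong (λ y → + 2 * a - c * y) Y0≡0 ⟩
      + 2 * a - c * 0ℤ               ≡⟨ drop (+ 2 * a) c ⟩
      + 2 * a                        ∎
      where
      drop : ∀ b c → b - c * 0ℤ ≡ b
      drop = solve-∀
    -- As `Y` is even, its correlation with its shift by `g` is the value of `Y ∗ Y` at `- g`.
    ∑YYg : ∑ n (λ i → Y i * Y (g + i)) ≡ + 2 * a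
    ∑YYg = begin
      ∑ n (λ i → Y i * Y (g + i))    ≡⟨ ∑-cong n (λ i → cong (Y i *_) (trans (sym (Y-even (g + i))) (cong Y (ℤ.neg-distrib-+ g i)))) ⟩
      ∑ n (λ i → Y i * Y (- g - i))  ≡⟨ Y∗Y (- g) ⟩
      + 2 * a - c * Y (- g)          ≡⟨ cong (_-_ (+ 2 * a)) (trans (cong (c *_) (Y-even g)) cYg≡0) ⟩
      + 2 * a - 0ℤ                   ≡⟨ ℤ.+-identityʳ (+ 2 * a) ⟩
      + 2 * a                        ∎
    ∑≡0 : ∑ n (λ i → (Y i - Y (g + i)) * (Y i - Y (g + i))) ≡ 0ℤ
    ∑≡0 = begin
      ∑ n (λ i → (Y i - Y (g + i)) * (Y i - Y (g + i)))
        ≡⟨ ∑-cong n (λ i → expand (Y i) (Y (g + i))) ⟩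
      ∑ n (λ i → (Y i * Y i + Y (g + i) * Y (g + i)) - + 2 * (Y i * Y (g + i)))
        ≡⟨ ∑-distrib-- n _ _ ⟩
      ∑ n (λ i → Y i * Y i + Y (g + i) * Y (g + i)) - ∑ n (λ i → + 2 * (Y i * Y (g + i)))
        ≡⟨ cong₂ _-_ (trans (∑-distrib-+ n _ _) (cong₂ _+_ ∑Y²
             (trans (∑-shift {n} {λ i → Y i * Y i} (λ i → cong₂ _*_ (Y-periodic i) (Y-periodic i)) g) ∑Y²)))
             (trans (*-distribˡ-∑ n (+ 2) _) (cong (+ 2 *_) ∑YYg)) ⟩
      (+ 2 * a + + 2 * a) - + 2 * (+ 2 * a)
        ≡⟨ cancel (+ 2 * a) ⟩
      0ℤ ∎
      where
      cancel : ∀ b → (b + b) - + 2 * b ≡ 0ℤ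
      cancel = solve-∀

  -- For `c = 0` every integer would be a period of `Y`, so `Y` would be constantly `Y 0 = 0`.
  c≢0 : ¬ (c ≡ 0ℤ)
  c≢0 c≡0 = Y≡0⇒⊥ (λ x → trans (cong Y (sym (ℤ.+-identityˡ x)))
    (trans (Y-shift-invariant x (trans (cong (_* Y x) c≡0) (ℤ.*-zeroˡ (Y x))) 0ℤ) Y0≡0))

  -- The left side of the equation depends on `x` only through `Y (x - i)`, so a period of `Y` is a
  -- period of `c * X`, and `c` can be cancelled.
  Y≡0⇒X-shift-invariant : ∀ g → Y g ≡ 0ℤ → ∀ x → X (x + g) ≡ X x
  Y≡0⇒X-shift-invariant g Yg≡0 x = ℤ.*-cancelˡ-≡ c _ _ {{ℤ.≢-nonZero c≢0}} (begin
    c * X (x + g)                                    ≡⟨ isolate a (c * X (x + g)) ⟩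
    a - (a - c * X (x + g))                          ≡⟨ cong (_-_ a) (sym (equation (x + g))) ⟩
    a - ∑ n (λ i → X i * Y (x + g - i))              ≡⟨ cong (_-_ a) (∑-cong n (λ i → cong (X i *_)
         (trans (cong Y (move x g i)) (Y-shift-invariant g cYg≡0 (x - i))))) ⟩
    a - ∑ n (λ i → X i * Y (x - i))                  ≡⟨ cong (_-_ a) (equation x) ⟩
    a - (a - c * X x)                                ≡⟨ sym (isolate a (c * X x)) ⟩
    c * X x                                          ∎)
    where
    cYg≡0 : c * Y g ≡ 0ℤ
    cYg≡0 = trans (cong (c *_) Yg≡0) (ℤ.*-zeroʳ c)
    isolate : ∀ a u → u ≡ a - (a - u)
    isolate = solve-∀
    move : ∀ x g i → x + g - i ≡ x - i + g
    move = solve-∀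

  -- Since `Y²` is a combination of `Y` and the constant function, so is every power. Applying the
  -- operator to the identity `δ n` recovers the group ring element.
  Y-powers : ∀ j → ∃[ β ] (∀ x → ap (convolution Y n OpExp.^ suc j) (δ n) x ≡ (- c) ^ᶻ j * Y x + β)
  Y-powers zero    = 0ℤ , λ x → trans (∑-*-δ n Y-periodic x) (unit (Y x))
    where
    unit : ∀ y → y ≡ 1ℤ * y + 0ℤ
    unit = solve-∀
  Y-powers (suc j) with Y-powers j
  -- The summand `e * 2a` comes from the constant part of `Y ∗ Y`, the other from convolving `Y`
  -- with the constant `β`.
  ... | β , ih = e * (+ 2 * a) + ∑ n Y * β , λ x → begin
    ∑ n (λ i → Y i * ap (convolution Y n OpExp.^ suc j) (δ n) (x - i))
      ≡⟨ ∑-cong n (λ i → trans (cong (Y i *_) (ih (x - i))) (distribute (Y i) e (Y (x - i)) β)) ⟩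
    ∑ n (λ i → e * (Y i * Y (x - i)) + Y i * β)
      ≡⟨ ∑-distrib-+ n _ _ ⟩
    ∑ n (λ i → e * (Y i * Y (x - i))) + ∑ n (λ i → Y i * β)
      ≡⟨ cong₂ _+_ (trans (*-distribˡ-∑ n e _) (cong (e *_) (Y∗Y x))) (*-distribʳ-∑ n β Y) ⟩
    e * (+ 2 * a - c * Y x) + ∑ n Y * β
      ≡⟨ collect e (+ 2 * a) c (Y x) (∑ n Y * β) ⟩
    - c * e * Y x + (e * (+ 2 * a) + ∑ n Y * β) ∎
    where
    e = (- c) ^ᶻ j
    distribute : ∀ y e z β → y * (e * z + β) ≡ e * (y * z) + y * β
    distribute = solve-∀
    collect : ∀ e b c y s → e * (b - c * y) + s ≡ (- c) * e * y + (e * b + s)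
    collect = solve-∀

  -- Y^p ≡ Σ Y(i) [p i] modulo p, and Y^p is an affine function of Y.
  frobenius : ∀ {p q} → Prime p → p ≡ suc q → ∃[ β ] (∀ x →
    + p ∣ ((- c) ^ᶻ q * Y x + β) - ∑ n (λ i → Y i * δ n (x - + p * i)))
  frobenius {p} {q} pr refl with Y-powers q
  ... | β , Y^p = β , λ x → subst (λ y → + p ∣ y - ∑ n (λ i → Y i * δ n (x - + p * i))) (Y^p x)
    (convolution-frobenius pr Y fermat-Y n (δ n) x)
    where
    fermat-Y : ∀ i → + p ∣ Y i ^ᶻ p - Y i
    fermat-Y i with Y-values i
    ... | k , _ , eq = subst (λ y → + p ∣ y ^ᶻ p - y) (sym eq) (fermat pr k)

-- Solutions over cyclic groups of odd prime power order

^-monoʳ-∣ : ∀ b {j k} → j ≤ k → b ^ j ℕ.∣ b ^ k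
^-monoʳ-∣ b {j} j≤k with ℕ.m≤n⇒∃[o]m+o≡n j≤k
... | i , refl = subst (b ^ j ℕ.∣_) (sym (ℕ.^-distribˡ-+-* b j i)) (ℕ.m∣m*n (b ^ i))

module PrimePowerSolutions {p : ℕ} (pr : Prime p) (2<p : 2 < p) where
  instance
    p≢0 : NonZero p
    p≢0 = prime⇒nonZero pr

  p∤1 : ¬ (+ p ∣ 1ℤ)
  p∤1 d = ℕ.>⇒∤ (ℕ.<-trans (s≤s (s≤s z≤n)) 2<p) (∣⇒∣ᵤ d)

  module Step {m : ℕ} .{{_ : NonZero m}} {X : ℤ → ℤ} {a c : ℤ} (sol : Solution (p ℕ.* m) X a c) where
    n = p ℕ.* m

    instance
      n≢0 : NonZero n
      n≢0 = ℕ.m*n≢0 p m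

    open Solution sol
    open SolutionProperties sol

    +n≡p*m : + n ≡ + p * + m
    +n≡p*m = ℤ.pos-* p m

    p∣n : + p ∣ + n
    p∣n = divides (+ m) (trans +n≡p*m (ℤ.*-comm (+ p) (+ m)))

    m∣n : + m ∣ + n
    m∣n = divides (+ p) +n≡p*m

    n∤1 : ¬ (+ n ∣ 1ℤ)
    n∤1 d = p∤1 (∣-trans p∣n d)

    -- The image of Y under multiplication by p on ℤ_n.
    Y⁽ᵖ⁾ : ℤ → ℤ
    Y⁽ᵖ⁾ x = ∑ n (λ i → Y i * δ n (x - + p * i))

    -- As `p` divides `n`, a number congruent to `p * i` modulo `n` is a multiple of `p`.
    Y⁽ᵖ⁾-∤ : ∀ x → ¬ (+ p ∣ x) → Y⁽ᵖ⁾ x ≡ 0ℤ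
    Y⁽ᵖ⁾-∤ x p∤x = trans (∑-cong n (λ i → trans (cong (Y i *_) (δ-∤ (n∤ i))) (ℤ.*-zeroʳ (Y i)))) (∑-zero n)
      where
      n∤ : ∀ i → ¬ (+ n ∣ x - + p * i)
      n∤ i d = p∤x (∣m+n∣n⇒∣m {m = x} (∣-trans p∣n d) (∣m⇒∣-m (∣m⇒∣m*n i ∣-refl)))

    n∣zp-pi⇒m∣z-i : ∀ z i → + n ∣ z * + p - + p * i → + m ∣ z - i
    n∣zp-pi⇒m∣z-i z i d = *-cancelˡ-∣ (+ p) (subst₂ _∣_ +n≡p*m (factor z (+ p) i) d)
      where
      factor : ∀ z p i → z * p - p * i ≡ p * (z - i)
      factor = solve-∀

    m∣z-i⇒n∣zp-pi : ∀ z i → + m ∣ z - i → + n ∣ z * + p - + p * i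
    m∣z-i⇒n∣zp-pi z i d = subst₂ _∣_ (sym +n≡p*m) (factor z (+ p) i) (*-monoʳ-∣ (+ p) d)
      where
      factor : ∀ z p i → p * (z - i) ≡ z * p - p * i
      factor = solve-∀

    -- Multiplication by `p` on ℤ_n has the kernel generated by `m`, so the solutions `i` of
    -- `p i = p z` form the class of `z` modulo `m`.
    δ-p : ∀ z i → δ n (z * + p - + p * i) ≡ δ m (z - i)
    δ-p z i = δ-iff (n∣zp-pi⇒m∣z-i z i) (m∣z-i⇒n∣zp-pi z i)

    periodic-m⇒n : ∀ {f} → Periodic m f → Periodic n f
    periodic-m⇒n {f} per x = trans (cong (λ k → f (x + k)) +n≡p*m) (periodic-* per (+ p) x)

    module _ (q : ℕ) (p≡1+q : p ≡ suc q) where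
      -- Up to constants, `Y^p` is `e` times `Y`.
      e : ℤ
      e = (- c) ^ᶻ q

      p∣e⇒p∣c : + p ∣ e → + p ∣ c
      p∣e⇒p∣c p∣e = subst (+ p ∣_) (ℤ.neg-involutive c) (∣m⇒∣-m (p∣a^n⇒p∣a pr (- c) q p∣e))

      frobenius-p : ∃[ β ] (∀ x → + p ∣ (e * Y x + β) - Y⁽ᵖ⁾ x)
      frobenius-p = frobenius pr p≡1+q

      β : ℤ
      β = proj₁ frobenius-p

      -- Induction on `j`; for `j = 0` there is no such `x`. By the Frobenius congruence it suffices
      -- that `p` divides `Y⁽ᵖ⁾ x`. This is clear if `p` does not divide `x`. If `x = z p`, then
      -- `Y⁽ᵖ⁾ x` adds up `Y i` over the `p` residues `i` modulo `n` congruent to `z` modulo `m`;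
      -- none is a multiple of `p ^ j`, so each `e * Y i` is `- β` modulo `p`, and `p` such terms
      -- cancel.
      Y-constant-mod-p : ¬ (+ p ∣ c) → ∀ α → m ≡ p ^ α → ∀ j → j ≤ suc α → ∀ x →
        ¬ (+ (p ^ j) ∣ x) → + p ∣ e * Y x + β
      Y-constant-mod-p p∤c α m≡p^α zero    _   x 1∤x = contradiction (divides x (sym (ℤ.*-identityʳ x))) 1∤x
      Y-constant-mod-p p∤c α m≡p^α (suc j) 1+j≤1+α x p^1+j∤x =
        subst (+ p ∣_) (restore (e * Y x + β) (Y⁽ᵖ⁾ x)) (∣m∣n⇒∣m+n (proj₂ frobenius-p x) p∣Y⁽ᵖ⁾)
        where
        restore : ∀ u v → (u - v) + v ≡ u
        restore = solve-∀
        p∣Y⁽ᵖ⁾ : + p ∣ Y⁽ᵖ⁾ x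
        p∣Y⁽ᵖ⁾ with + p ∣? x
        ... | no p∤x = subst (+ p ∣_) (sym (Y⁽ᵖ⁾-∤ x p∤x)) (divides 0ℤ refl)
        -- The induction hypothesis is about `e * Y i`, so `e * Y⁽ᵖ⁾ x` is treated and `e`, prime to
        -- `p`, is removed by Euclid's lemma.
        ... | yes (divides z refl) = [ (λ p∣e → contradiction (p∣e⇒p∣c p∣e) p∤c) , (λ d → d) ]′
            (ℤ-euclidsLemma pr e (Y⁽ᵖ⁾ x) (subst (+ p ∣_) (sym e*Y⁽ᵖ⁾) (∣m∣n⇒∣m-n p∣first p∣second)))
          where
          Δ : ℤ → ℤ
          Δ i = δ n (x - + p * i)
          split : ∀ e y β d → e * (y * d) ≡ (e * y + β) * d - β * d
          split = solve-∀
          e*Y⁽ᵖ⁾ : e * Y⁽ᵖ⁾ x ≡ ∑ n (λ i → (e * Y i + β) * Δ i) - β * ∑ n Δ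
          e*Y⁽ᵖ⁾ = begin
            e * Y⁽ᵖ⁾ x                                            ≡⟨ sym (*-distribˡ-∑ n e _) ⟩
            ∑ n (λ i → e * (Y i * Δ i))                           ≡⟨ ∑-cong n (λ i → split e (Y i) β (Δ i)) ⟩
            ∑ n (λ i → (e * Y i + β) * Δ i - β * Δ i)             ≡⟨ ∑-distrib-- n _ _ ⟩
            ∑ n (λ i → (e * Y i + β) * Δ i) - ∑ n (λ i → β * Δ i) ≡⟨ cong (_-_ (∑ n (λ i → (e * Y i + β) * Δ i))) (*-distribˡ-∑ n β Δ) ⟩
            ∑ n (λ i → (e * Y i + β) * Δ i) - β * ∑ n Δ           ∎
          p^j∤z : ¬ (+ (p ^ j) ∣ z)
          p^j∤z (divides k refl) = p^1+j∤x (divides k (trans (swap k _ _) (cong (k *_) (sym (ℤ.pos-* p (p ^ j))))))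
            where
            swap : ∀ k u p → k * u * p ≡ k * (p * u)
            swap = solve-∀
          p^j∣m : + (p ^ j) ∣ + m
          p^j∣m = subst (λ k → + (p ^ j) ∣ + k) (sym m≡p^α)
            (∣ᵤ⇒∣ (^-monoʳ-∣ p (ℕ.≤-pred 1+j≤1+α)))
          p∣first : + p ∣ ∑ n (λ i → (e * Y i + β) * Δ i)
          p∣first = ∑-∣ n term
            where
            recover : ∀ z i → (z - i) + i ≡ z
            recover = solve-∀
            term : ∀ i → + p ∣ (e * Y i + β) * Δ i
            term i with + n ∣? (x - + p * i)
            ... | no _  = divides 0ℤ (trans (ℤ.*-zeroʳ (e * Y i + β)) (sym (ℤ.*-zeroˡ (+ p))))
            ... | yes d = ∣m⇒∣m*n 1ℤ (Y-constant-mod-p p∤c α m≡p^α j (ℕ.<⇒≤ 1+j≤1+α) i (λ p^j∣i →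
              p^j∤z (subst (+ (p ^ j) ∣_) (recover z i)
                (∣m∣n⇒∣m+n (∣-trans p^j∣m (n∣zp-pi⇒m∣z-i z i d)) p^j∣i))))
          p∣second : + p ∣ β * ∑ n Δ
          p∣second = ∣n⇒∣m*n β (subst (+ p ∣_) (sym ∑Δ) (∣m⇒∣m*n (∑ m (δ m)) ∣-refl))
            where
            ∑Δ : ∑ n Δ ≡ + p * ∑ m (δ m)
            ∑Δ = begin
              ∑ n Δ                    ≡⟨ ∑-cong n (δ-p z) ⟩
              ∑ n (λ i → δ m (z - i))  ≡⟨ ∑-reflect-shift (periodic-m⇒n (δ-periodic m)) z ⟩
              ∑ n (δ m)                ≡⟨ ∑-blocks (δ-periodic m) p ⟩
              + p * ∑ m (δ m)          ∎

      -- Two values of `Y` off 0 are congruent modulo `p`; they lie in `{0,1,2}` and `p > 2`, so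
      -- they are equal.
      Y-constant : ¬ (+ p ∣ c) → ∀ α → m ≡ p ^ α → ∀ x → ¬ (+ n ∣ x) → Y x ≡ Y 1ℤ
      Y-constant p∤c α m≡p^α x n∤x = ℤ.i-j≡0⇒i≡j (Y x) (Y 1ℤ) (∣∧abs<⇒≡0 p∣Yx-Y1 (small (Y-values x) (Y-values 1ℤ)))
        where
        p∣e[Yx+β] : ∀ x → ¬ (+ n ∣ x) → + p ∣ e * Y x + β
        p∣e[Yx+β] x n∤x = Y-constant-mod-p p∤c α m≡p^α (suc α) ℕ.≤-refl x
          (λ d → n∤x (subst (λ k → + (p ℕ.* k) ∣ x) (sym m≡p^α) d))
        difference : ∀ e u v β → (e * u + β) - (e * v + β) ≡ e * (u - v)
        difference = solve-∀
        p∣Yx-Y1 : + p ∣ Y x - Y 1ℤ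
        p∣Yx-Y1 = [ (λ p∣e → contradiction (p∣e⇒p∣c p∣e) p∤c) , (λ d → d) ]′
          (ℤ-euclidsLemma pr e (Y x - Y 1ℤ) (subst (+ p ∣_) (difference e (Y x) (Y 1ℤ) β)
            (∣m∣n⇒∣m-n (p∣e[Yx+β] x n∤x) (p∣e[Yx+β] 1ℤ n∤1))))
        small : ∀ {u v} → ∃[ k ] (k ≤ 2 × u ≡ + k) → ∃[ l ] (l ≤ 2 × v ≡ + l) → ∣ u - v ∣ < p
        small (k , k≤2 , refl) (l , l≤2 , refl) = ℕ.≤-<-trans
          (subst (ℕ._≤ 2) (cong ∣_∣ (sym (ℤ.m-n≡m⊖n k l))) (ℕ.≤-trans (ℤ.∣m⊝n∣≤m⊔n k l) (ℕ.⊔-lub k≤2 l≤2))) 2<p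

      -- Modulo `p` the term `e * Y` drops out, so `Y⁽ᵖ⁾` is congruent to `β`, which is 0 because
      -- `Y⁽ᵖ⁾ 1` is. At 0 this says that `p` divides twice the number `s` of elements of `X` in the
      -- subgroup generated by `m`. That subgroup has order `p` and `X` misses 0, so `s = 0`; hence
      -- `Y m = 0` and `m` is a period of `X`.
      p∣c⇒X-m-periodic : 0 < q → + p ∣ c → Periodic m X
      p∣c⇒X-m-periodic 0<q p∣c x = Y≡0⇒X-shift-invariant (+ m) (cong₂ _+_ (X-vanishes (+ m) ∣-refl) (X-vanishes (- + m) (∣m⇒∣-m ∣-refl))) x
        where
        p∣e : + p ∣ e
        p∣e = p∣-c^ q 0<q
          where
          p∣-c^ : ∀ q → 0 < q → + p ∣ (- c) ^ᶻ q
          p∣-c^ (suc q′) _ = ∣m⇒∣m*n ((- c) ^ᶻ q′) (∣m⇒∣-m p∣c)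
        p∣β-Y⁽ᵖ⁾ : ∀ x → + p ∣ β - Y⁽ᵖ⁾ x
        p∣β-Y⁽ᵖ⁾ x = subst (+ p ∣_) (drop (e * Y x) β (Y⁽ᵖ⁾ x)) (∣m∣n⇒∣m-n (proj₂ frobenius-p x) (∣m⇒∣m*n (Y x) p∣e))
          where
          drop : ∀ u β v → ((u + β) - v) - u ≡ β - v
          drop = solve-∀
        p∣β : + p ∣ β
        p∣β = subst (+ p ∣_) (trans (cong (_-_ β) (Y⁽ᵖ⁾-∤ 1ℤ p∤1)) (ℤ.+-identityʳ β)) (p∣β-Y⁽ᵖ⁾ 1ℤ)
        p∣Y⁽ᵖ⁾0 : + p ∣ Y⁽ᵖ⁾ 0ℤ
        p∣Y⁽ᵖ⁾0 = subst (+ p ∣_) (cancel β (Y⁽ᵖ⁾ 0ℤ)) (∣m∣n⇒∣m-n p∣β (p∣β-Y⁽ᵖ⁾ 0ℤ))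
          where
          cancel : ∀ β v → β - (β - v) ≡ v
          cancel = solve-∀
        s : ℤ
        s = ∑ n (λ i → X i * δ m i)
        δ-even : ∀ i → δ m (- i) ≡ δ m i
        δ-even i = δ-iff (λ d → subst (+ m ∣_) (ℤ.neg-involutive i) (∣m⇒∣-m d)) ∣m⇒∣-m
        Xδ-periodic : Periodic n (λ i → X i * δ m i)
        Xδ-periodic i = cong₂ _*_ (periodic i) (periodic-m⇒n (δ-periodic m) i)
        Y⁽ᵖ⁾0≡2s : Y⁽ᵖ⁾ 0ℤ ≡ + 2 * s
        Y⁽ᵖ⁾0≡2s = begin
          ∑ n (λ i → Y i * δ n (0ℤ - + p * i))
            ≡⟨ ∑-cong n (λ i → cong (Y i *_) (trans (δ-p 0ℤ i) (trans (cong (δ m) (ℤ.+-identityˡ (- i))) (δ-even i)))) ⟩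
          ∑ n (λ i → Y i * δ m i)
            ≡⟨ ∑-cong n (λ i → trans (ℤ.*-distribʳ-+ (δ m i) (X i) (X (- i)))
                 (cong (λ d → X i * δ m i + X (- i) * d) (sym (δ-even i)))) ⟩
          ∑ n (λ i → X i * δ m i + X (- i) * δ m (- i))
            ≡⟨ ∑-distrib-+ n _ _ ⟩
          s + ∑ n (λ i → X (- i) * δ m (- i))
            ≡⟨ cong (_+_ s) (∑-reflect Xδ-periodic) ⟩
          s + s
            ≡⟨ twice s ⟩
          + 2 * s ∎
          where
          twice : ∀ s → s + s ≡ + 2 * s
          twice = solve-∀
        p∣s : + p ∣ s
        p∣s = [ (λ p∣2 → contradiction (∣⇒∣ᵤ p∣2) (ℕ.>⇒∤ 2<p)) , (λ d → d) ]′
          (ℤ-euclidsLemma pr (+ 2) s (subst (+ p ∣_) Y⁽ᵖ⁾0≡2s p∣Y⁽ᵖ⁾0))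
        Xδ-nonNeg : ∀ i → 0ℤ ℤ.≤ X i * δ m i
        Xδ-nonNeg i with + m ∣? i
        ... | yes _ = subst (0ℤ ℤ.≤_) (sym (ℤ.*-identityʳ (X i))) (binary-nonNeg binary i)
        ... | no _  = subst (0ℤ ℤ.≤_) (sym (ℤ.*-zeroʳ (X i))) ℤ.≤-refl
        -- Of the p multiples of m modulo n, at least 0 is missing from X.
        Xδ≤ : ∀ i → X i * δ m i ℤ.≤ δ m i - δ n i
        Xδ≤ i with + n ∣? i
        ... | yes d = subst₂ ℤ._≤_
          (sym (trans (cong (_* δ m i) (trans (periodic-∣ periodic (subst (+ n ∣_) (sym (ℤ.+-identityʳ i)) d)) X0≡0)) (ℤ.*-zeroˡ (δ m i))))
          (sym (cong (_- 1ℤ) (δ-∣ (∣-trans m∣n d)))) ℤ.≤-refl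
        ... | no _ = subst (X i * δ m i ℤ.≤_) (sym (ℤ.+-identityʳ (δ m i))) (Xδ≤δ (binary i))
          where
          Xδ≤δ : X i ≡ 0ℤ ⊎ X i ≡ 1ℤ → X i * δ m i ℤ.≤ δ m i
          Xδ≤δ (inj₁ eq) = subst (λ u → u * δ m i ℤ.≤ δ m i) (sym eq) (subst (ℤ._≤ δ m i) (sym (ℤ.*-zeroˡ (δ m i))) (δ-nonNeg m i))
          Xδ≤δ (inj₂ eq) = ℤ.≤-reflexive (trans (cong (_* δ m i) eq) (ℤ.*-identityˡ (δ m i)))
        s≤p-1 : s ℤ.≤ + p - 1ℤ
        s≤p-1 = subst (s ℤ.≤_) (trans (∑-distrib-- n (δ m) (δ n)) (cong₂ _-_
            (trans (∑-blocks (δ-periodic m) p) (trans (cong (+ p *_) (∑-δ m)) (ℤ.*-identityʳ (+ p))))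
            (∑-δ n)))
          (∑-mono-≤ n Xδ≤)
        s<p : s ℤ.< + p
        s<p = ℤ.≤-<-trans s≤p-1 (subst (+ p - 1ℤ ℤ.<_) (ℤ.+-identityʳ (+ p)) (ℤ.+-monoʳ-< (+ p) ℤ.-<+))
        0≤s : 0ℤ ℤ.≤ s
        0≤s = ∑-nonNeg n Xδ-nonNeg
        s≡0 : s ≡ 0ℤ
        s≡0 = ∣∧abs<⇒≡0 p∣s (ℤ.drop‿+<+ (subst (ℤ._< + p) (sym (ℤ.0≤i⇒+∣i∣≡i 0≤s)) s<p))
        X-vanishes : ∀ x → + m ∣ x → X x ≡ 0ℤ
        X-vanishes x d = trans (sym (ℤ.*-identityʳ (X x))) (trans (cong (X x *_) (sym (δ-∣ d)))
          (∑≡0⇒≡0 n Xδ-periodic Xδ-nonNeg s≡0 x))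

    -- The value 0 would make `Y` vanish identically. With the value 2, the equation at 0 would read
    -- `a = 2|X|`, against the strict upper bound on `a`.
    Y1≡1 : (∀ x → ¬ (+ n ∣ x) → Y x ≡ Y 1ℤ) → Y 1ℤ ≡ 1ℤ
    Y1≡1 Y≡Y1 with Y-values 1ℤ
    ... | 0 , _ , Y1≡0 = contradiction Y≡0 Y≡0⇒⊥
      where
      Y≡0 : ∀ x → Y x ≡ 0ℤ
      Y≡0 x with + n ∣? x
      ... | yes d  = trans (periodic-∣ Y-periodic (subst (+ n ∣_) (sym (ℤ.+-identityʳ x)) d)) Y0≡0
      ... | no n∤x = trans (Y≡Y1 x n∤x) Y1≡0
    ... | 1 , _ , Y1≡1 = Y1≡1
    ... | 2 , _ , Y1≡2 = contradiction a≡2∣X∣ (ℤ.<⇒≢ a<2∣X∣)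
      where
      XY≡2X : ∀ i → X i * Y (0ℤ - i) ≡ + 2 * X i
      XY≡2X i with + n ∣? i
      ... | yes d = trans (cong (_* Y (0ℤ - i)) Xi≡0) (trans (ℤ.*-zeroˡ (Y (0ℤ - i))) (sym (cong (+ 2 *_) Xi≡0)))
        where
        Xi≡0 : X i ≡ 0ℤ
        Xi≡0 = trans (periodic-∣ periodic (subst (+ n ∣_) (sym (ℤ.+-identityʳ i)) d)) X0≡0
      ... | no n∤i = trans (cong (X i *_) (trans (cong Y (ℤ.+-identityˡ (- i)))
                       (trans (Y-even i) (trans (Y≡Y1 i n∤i) Y1≡2)))) (ℤ.*-comm (X i) (+ 2))
      drop : ∀ a c → a - c * 0ℤ ≡ a
      drop = solve-∀
      a≡2∣X∣ : a ≡ + 2 * ∑ n X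
      a≡2∣X∣ = begin
        a                                ≡⟨ sym (drop a c) ⟩
        a - c * 0ℤ                       ≡⟨ cong (λ u → a - c * u) (sym X0≡0) ⟩
        a - c * X 0ℤ                     ≡⟨ sym (equation 0ℤ) ⟩
        ∑ n (λ i → X i * Y (0ℤ - i))     ≡⟨ ∑-cong n XY≡2X ⟩
        ∑ n (λ i → + 2 * X i)            ≡⟨ *-distribˡ-∑ n (+ 2) X ⟩
        + 2 * ∑ n X                      ∎
    ... | suc (suc (suc _)) , s≤s (s≤s ()) , _

    -- Once `m` is a period, each sum over `n` is `p` times the sum over `m`. At 0 the equation
    -- shows that `p` divides `a`, with quotient `a′`; then everything can be divided by `p`.
    reduce : Periodic m X → + p ∣ c → ∃[ a′ ] ∃[ c′ ] Solution m X a′ c′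
    reduce per (divides c′ c≡c′p) = a′ , c′ , record
      { periodic = per
      ; binary   = binary
      ; X0≡0     = X0≡0
      ; equation = λ x → ℤ.*-cancelˡ-≡ (+ p) _ _ (trans (sym (blocks x)) (trans (equation x)
                     (trans (cong₂ (λ u v → u - v * X x) a≡pa′ c≡c′p) (factor (+ p) a′ c′ (X x)))))
      ; 0<a      = ℤ.*-cancelˡ-<-nonNeg (+ p) (subst₂ ℤ._<_ (sym (ℤ.*-zeroʳ (+ p))) a≡pa′ 0<a)
      ; a<2∣X∣   = ℤ.*-cancelˡ-<-nonNeg (+ p) (subst₂ ℤ._<_ a≡pa′
                     (trans (cong (+ 2 *_) (∑-blocks per p)) (swap (+ p) (∑ m X))) a<2∣X∣)
      }
      where
      XY : ℤ → ℤ → ℤ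
      XY x i = X i * Y (x - i)
      a′ : ℤ
      a′ = ∑ m (XY 0ℤ)
      XY-periodic : ∀ x → Periodic m (XY x)
      XY-periodic x i = cong₂ _*_ (per i) (periodic-reflect (symmetrize-periodic per) x i)
      blocks : ∀ x → ∑ n (XY x) ≡ + p * ∑ m (XY x)
      blocks x = ∑-blocks (XY-periodic x) p
      drop : ∀ a c → a ≡ a - c * 0ℤ
      drop = solve-∀
      a≡pa′ : a ≡ + p * a′
      a≡pa′ = trans (drop a c) (trans (cong (λ u → a - c * u) (sym X0≡0)) (trans (sym (equation 0ℤ)) (blocks 0ℤ)))
      factor : ∀ p a c x → p * a - c * p * x ≡ p * (a - c * x)
      factor = solve-∀
      swap : ∀ p s → + 2 * (p * s) ≡ p * (+ 2 * s)
      swap = solve-∀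

    dichotomy : ∀ α → m ≡ p ^ α →
      (∀ x → ¬ (+ n ∣ x) → Y x ≡ 1ℤ) ⊎ (∃[ a′ ] ∃[ c′ ] Solution m X a′ c′)
    dichotomy α m≡p^α = [ (λ p∣c → inj₂ (reduce (p∣c⇒X-m-periodic q p≡1+q 0<q p∣c) p∣c))
                        , (λ p∤c → inj₁ (Y≡1 (Y-constant q p≡1+q p∤c α m≡p^α))) ]′ (toSum (+ p ∣? c))
      where
      q = ℕ.pred p
      p≡1+q : p ≡ suc q
      p≡1+q = sym (ℕ.suc-pred p)
      0<q : 0 < q
      0<q = ℕ.≤-pred (subst (2 ≤_) p≡1+q (ℕ.<⇒≤ 2<p))
      Y≡1 : (∀ x → ¬ (+ n ∣ x) → Y x ≡ Y 1ℤ) → ∀ x → ¬ (+ n ∣ x) → Y x ≡ 1ℤ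
      Y≡1 Y≡Y1 x n∤x = trans (Y≡Y1 x n∤x) (Y1≡1 Y≡Y1)

  -- The value 1 of `symmetrize X` states (i) and (ii) together off 0: exactly one of `x` and `- x`
  -- is in the set, as in the connection set of a circulant tournament.
  TournamentLift : ℕ → (ℤ → ℤ) → Set
  TournamentLift α X = ∃[ γ ] (1 ≤ γ × γ ≤ α ×
    Periodic (p ^ γ) X × (∀ x → ¬ (+ (p ^ γ) ∣ x) → symmetrize X x ≡ 1ℤ))

  classify : ∀ α {X a c} → Solution (p ^ α) X a c → TournamentLift α X
  -- Over the trivial group `|X| = X 0 = 0`, so the bounds on `a` contradict each other.
  classify zero {X} {a} sol = contradiction (ℤ.<-trans 0<a (subst (λ s → a ℤ.< + 2 * s)
      (trans (ℤ.+-identityˡ (X 0ℤ)) X0≡0) a<2∣X∣)) (ℤ.<-irrefl refl)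
    where open Solution sol
  classify (suc α) {X} sol =
    [ (λ Y≡1 → suc α , s≤s z≤n , ℕ.≤-refl , Solution.periodic sol , Y≡1)
    , (λ (_ , _ , sol′) → weaken (classify α sol′)) ]′
    (Step.dichotomy {{ℕ.m^n≢0 p α}} sol α refl)
    where
    weaken : TournamentLift α X → TournamentLift (suc α) X
    weaken (γ , 1≤γ , γ≤α , rest) = γ , 1≤γ , ℕ.m≤n⇒m≤1+n γ≤α , rest

-- Dihedrants

⟦_⟧ : ∀ {n} → Fin n → ℤ
⟦ i ⟧ = + toℕ i

-- The operations `mod`, `+ₙ`, `-ₙ` and `ψ` are all expressed through this map, which turns
-- equalities in `Fin n` into divisibility in ℤ.
residue : ∀ n .{{_ : NonZero n}} → ℤ → Fin n
residue n z = fromℕ< (n%ℕd<d z n)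

residue-∣ : ∀ n .{{_ : NonZero n}} z → + n ∣ z - ⟦ residue n z ⟧
residue-∣ n z = divides (z /ℕ n) (trans (cong₂ _-_ (a≡a%ℕn+[a/ℕn]*n z n) (cong +_ (toℕ-fromℕ< (n%ℕd<d z n))))
  (cancel (+ (z %ℕ n)) (z /ℕ n * + n)))
  where
  cancel : ∀ r q → (r + q) - r ≡ q
  cancel = solve-∀

∣-Fin⇒≡ : ∀ {n} (i j : Fin n) → + n ∣ ⟦ i ⟧ - ⟦ j ⟧ → i ≡ j
∣-Fin⇒≡ i j d = toℕ-injective (ℤ.+-injective (ℤ.i-j≡0⇒i≡j ⟦ i ⟧ ⟦ j ⟧ (∣∧abs<⇒≡0 d
  (subst (_< _) (cong ∣_∣ (sym (ℤ.m-n≡m⊖n (toℕ i) (toℕ j))))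
    (ℕ.≤-<-trans (ℤ.∣m⊝n∣≤m⊔n (toℕ i) (toℕ j)) (ℕ.⊔-lub (toℕ<n i) (toℕ<n j)))))))

residue-unique : ∀ n .{{_ : NonZero n}} z (i : Fin n) → + n ∣ z - ⟦ i ⟧ → residue n z ≡ i
residue-unique n z i d = ∣-Fin⇒≡ (residue n z) i
  (subst (+ n ∣_) (telescope z ⟦ i ⟧ ⟦ residue n z ⟧) (∣m∣n⇒∣m-n d (residue-∣ n z)))
  where
  telescope : ∀ z i r → (z - i) - (z - r) ≡ r - i
  telescope = solve-∀

residue-⟦⟧ : ∀ n .{{_ : NonZero n}} (i : Fin n) → residue n ⟦ i ⟧ ≡ i
residue-⟦⟧ n i = residue-unique n ⟦ i ⟧ i (divides 0ℤ (ℤ.+-inverseʳ ⟦ i ⟧))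

residue-cong : ∀ n .{{_ : NonZero n}} x y → + n ∣ x - y → residue n x ≡ residue n y
residue-cong n x y d = residue-unique n x (residue n y)
  (subst (+ n ∣_) (telescope x y ⟦ residue n y ⟧) (∣m∣n⇒∣m+n d (residue-∣ n y)))
  where
  telescope : ∀ x y r → (x - y) + (y - r) ≡ x - r
  telescope = solve-∀

mod-residue : ∀ k n .{{_ : NonZero n}} → k mod n ≡ residue n (+ k)
mod-residue k n = toℕ-injective (trans (toℕ-fromℕ< (ℕ.m%n<n k n)) (sym (toℕ-fromℕ< (n%ℕd<d (+ k) n))))

+ₙ-residue : ∀ n .{{_ : NonZero n}} (i j : Fin n) → i +ₙ j ≡ residue n (⟦ i ⟧ + ⟦ j ⟧)
+ₙ-residue (suc m) i j = mod-residue (toℕ i ℕ.+ toℕ j) (suc m)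

-ₙ-residue : ∀ n .{{_ : NonZero n}} (i : Fin n) → -ₙ i ≡ residue n (- ⟦ i ⟧)
-ₙ-residue n@(suc m) i = trans (mod-residue (n ℕ.∸ toℕ i) n)
  (residue-cong n (+ (n ℕ.∸ toℕ i)) (- ⟦ i ⟧) (divides 1ℤ
    (trans (cong (_- - ⟦ i ⟧) (trans (sym (ℤ.⊖-≥ (ℕ.<⇒≤ (toℕ<n i)))) (sym (ℤ.m-n≡m⊖n n (toℕ i))))) (cancel (+ n) ⟦ i ⟧))))
  where
  cancel : ∀ n i → (n - i) - - i ≡ 1ℤ * n
  cancel = solve-∀

indicator : ∀ {n} .{{_ : NonZero n}} → Subset n → ℤ → ℤ
indicator {n} X z = ind (does (residue n z ∈? X))

module _ {n : ℕ} .{{_ : NonZero n}} (X : Subset n) where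
  indicator-periodic : Periodic n (indicator X)
  indicator-periodic x = cong (λ i → ind (does (i ∈? X))) (residue-cong n (x + + n) x (divides 1ℤ (cancel x (+ n))))
    where
    cancel : ∀ x n → (x + n) - x ≡ 1ℤ * n
    cancel = solve-∀

  indicator-binary : Binary (indicator X)
  indicator-binary z with residue n z ∈? X
  ... | yes _ = inj₂ refl
  ... | no _  = inj₁ refl

  ∈⇒indicator : ∀ z → residue n z ∈ X → indicator X z ≡ 1ℤ
  ∈⇒indicator z z∈X with residue n z ∈? X
  ... | yes _  = refl
  ... | no z∉X = contradiction z∈X z∉X

  indicator⇒∈ : ∀ z → indicator X z ≡ 1ℤ → residue n z ∈ X
  indicator⇒∈ z h with residue n z ∈? X | h
  ... | yes z∈X | _  = z∈X
  ... | no _    | ()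

  ∉⇒indicator : ∀ z → residue n z ∉ X → indicator X z ≡ 0ℤ
  ∉⇒indicator z z∉X with residue n z ∈? X
  ... | yes z∈X = contradiction z∈X z∉X
  ... | no _    = refl

-- The counterpart of `twist` on integers.
signed : Bool → ℤ → ℤ
signed false z = z
signed true  z = - z

ind-∧ : ∀ a b → ind (a ∧ b) ≡ ind a * ind b
ind-∧ true  b = sym (ℤ.*-identityˡ (ind b))
ind-∧ false b = sym (ℤ.*-zeroˡ (ind b))

count-∷ : ∀ {V : Set} (v : V) vs (P : V → Bool) → + count (v ∷ vs) P ≡ ind (P v) + + count vs P
count-∷ v vs P with P v
... | true  = refl
... | false = refl

-- Stated for an arbitrary `f`, so that the induction hypothesis applies to `f ∘ suc`.
count-pairs : ∀ {k n} (f : Fin k → Fin n) (P : D n → Bool) →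
  + count (concatMap (λ i → (i , false) ∷ (i , true) ∷ []) (tabulateᴸ f)) P
  ≡ sum (λ i → ind (P (f i , false)) + ind (P (f i , true)))
count-pairs {zero}  f P = refl
count-pairs {suc k} f P = begin
  + count ((f zero , false) ∷ (f zero , true) ∷ rest) P
    ≡⟨ count-∷ (f zero , false) ((f zero , true) ∷ rest) P ⟩
  ind (P (f zero , false)) + + count ((f zero , true) ∷ rest) P
    ≡⟨ cong (_+_ (ind (P (f zero , false)))) (trans (count-∷ (f zero , true) rest P)
         (cong (_+_ (ind (P (f zero , true)))) (count-pairs (f ∘ suc) P))) ⟩
  ind (P (f zero , false)) + (ind (P (f zero , true)) + sum (λ i → ind (P (f (suc i) , false)) + ind (P (f (suc i) , true))))
    ≡⟨ sym (ℤ.+-assoc (ind (P (f zero , false))) _ _) ⟩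
  sum (λ i → ind (P (f i , false)) + ind (P (f i , true))) ∎
  where
  rest = concatMap (λ i → (i , false) ∷ (i , true) ∷ []) (tabulateᴸ (f ∘ suc))

-- `sum` takes off the first term and `∑` the last; `∑-shift-1` mediates.
sum≡∑ : ∀ n (F : ℤ → ℤ) → sum {n} (λ i → F ⟦ i ⟧) ≡ ∑ n F
sum≡∑ zero    F = refl
sum≡∑ (suc n) F = trans (cong (_+_ (F 0ℤ)) (sum≡∑ n (λ z → F (1ℤ + z))))
  (trans (ℤ.+-comm (F 0ℤ) _) (∑-shift-1 n F))

count-allD : ∀ {n} (P : D n → Bool) (F : ℤ → ℤ) →
  (∀ i → ind (P (i , false)) + ind (P (i , true)) ≡ F ⟦ i ⟧) → + count (allD n) P ≡ ∑ n F
count-allD {n} P F eq = trans (count-pairs (λ i → i) P) (trans (sum-cong-≗ eq) (sum≡∑ n F))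

module Dihedrant {n : ℕ} .{{_ : NonZero n}} (X : Subset n) where
  χ : ℤ → ℤ
  χ = indicator X

  χ-periodic : Periodic n χ
  χ-periodic = indicator-periodic X

  arc : D n → D n → Bool
  arc = dihArc X X

  ind-inS : ∀ i b z → i ≡ residue n z → ind (inS X X (i , b)) ≡ χ z
  ind-inS i false z refl = refl
  ind-inS i true  z refl = refl

  -- For `g = x^i` the rotation part of `g⁻¹h` is `j - i`; for the involution `g = x^i a` it is
  -- `i - j`. Both halves of the connection set are `X`, so the rotation part alone decides.
  ind-arc : ∀ i b j c → ind (arc (i , b) (j , c)) ≡ χ (signed b (⟦ j ⟧ - ⟦ i ⟧))
  ind-arc i false j c = ind-inS _ c (⟦ j ⟧ - ⟦ i ⟧) (trans (+ₙ-residue n (-ₙ i) j)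
    (residue-cong n (⟦ -ₙ i ⟧ + ⟦ j ⟧) (⟦ j ⟧ - ⟦ i ⟧)
      (subst (λ k → + n ∣ (⟦ k ⟧ + ⟦ j ⟧) - (⟦ j ⟧ - ⟦ i ⟧)) (sym (-ₙ-residue n i))
        (subst (+ n ∣_) (rearrange ⟦ i ⟧ ⟦ j ⟧ _) (∣m⇒∣-m (residue-∣ n (- ⟦ i ⟧)))))))
    where
    rearrange : ∀ i j r → - (- i - r) ≡ (r + j) - (j - i)
    rearrange = solve-∀
  ind-arc i true j c = ind-inS _ (true xor c) (- (⟦ j ⟧ - ⟦ i ⟧)) (trans (+ₙ-residue n i (-ₙ j))
    (residue-cong n (⟦ i ⟧ + ⟦ -ₙ j ⟧) (- (⟦ j ⟧ - ⟦ i ⟧))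
      (subst (λ k → + n ∣ (⟦ i ⟧ + ⟦ k ⟧) - - (⟦ j ⟧ - ⟦ i ⟧)) (sym (-ₙ-residue n j))
        (subst (+ n ∣_) (rearrange ⟦ i ⟧ ⟦ j ⟧ _) (∣m⇒∣-m (residue-∣ n (- ⟦ j ⟧)))))))
    where
    rearrange : ∀ i j r → - (- j - r) ≡ (i + r) - - (j - i)
    rearrange = solve-∀

  outDegree : ∀ i b → + count (allD n) (λ y → arc (i , b) y) ≡ ∑ n (λ z → + 2 * χ (signed b (z - ⟦ i ⟧)))
  outDegree i b = count-allD _ (λ z → + 2 * χ (signed b (z - ⟦ i ⟧)))
    (λ j → trans (cong₂ _+_ (ind-arc i b j false) (ind-arc i b j true)) (twice (χ (signed b (⟦ j ⟧ - ⟦ i ⟧)))))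
    where
    twice : ∀ s → s + s ≡ + 2 * s
    twice = solve-∀

  inDegree : ∀ j c → + count (allD n) (λ x → arc x (j , c)) ≡ ∑ n (λ z → symmetrize χ (⟦ j ⟧ - z))
  inDegree j c = count-allD _ (λ z → symmetrize χ (⟦ j ⟧ - z)) (λ i → cong₂ _+_ (ind-arc i false j c) (ind-arc i true j c))

  -- The middle vertex may be a rotation or a reflection with the same exponent; adding the two
  -- second steps produces `X + X⁽⁻¹⁾`.
  twoStepPaths : ∀ i b j c → + count (allD n) (λ z → arc (i , b) z ∧ arc z (j , c))
    ≡ ∑ n (λ z → χ (signed b (z - ⟦ i ⟧)) * symmetrize χ (⟦ j ⟧ - z))
  twoStepPaths i b j c = count-allD _ (λ z → χ (signed b (z - ⟦ i ⟧)) * symmetrize χ (⟦ j ⟧ - z)) (λ k →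
    trans (cong₂ _+_ (through k false) (through k true)) (sym (ℤ.*-distribˡ-+ (χ (signed b (⟦ k ⟧ - ⟦ i ⟧))) _ _)))
    where
    through : ∀ k d → ind (arc (i , b) (k , d) ∧ arc (k , d) (j , c))
      ≡ χ (signed b (⟦ k ⟧ - ⟦ i ⟧)) * χ (signed d (⟦ j ⟧ - ⟦ k ⟧))
    through k d = trans (ind-∧ (arc (i , b) (k , d)) _) (cong₂ _*_ (ind-arc i b k d) (ind-arc k d j c))

-- Directed strongly regular dihedrants and the group ring equation

⌊⌋-true : ∀ {A : Set} (a? : Dec A) → A → ⌊ a? ⌋ ≡ true
⌊⌋-true (yes _) a = refl
⌊⌋-true (no ¬a) a = contradiction a ¬a

⌊⌋-false : ∀ {A : Set} (a? : Dec A) → ¬ A → ⌊ a? ⌋ ≡ false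
⌊⌋-false (yes a) ¬a = contradiction a ¬a
⌊⌋-false (no _)  ¬a = refl

module _ {n : ℕ} .{{_ : NonZero n}} (X : Subset n) where
  open Dihedrant X

  -- The identity's row of `A²` is `X(X + X⁽⁻¹⁾)`, on rotations and on reflections alike. The bounds
  -- on `a` are `0 < t < k`, because `t = μ` and `k = 2|X|`.
  dsrg⇒solution : (∀ x → toℕ x ≡ 0 → x ∉ X) → IsDSRGDih n X X → ∃[ a ] ∃[ c ] Solution n χ a c
  dsrg⇒solution 0∉X (params v k μ lam t , dsrg) = + μ , + μ - + lam , record
    { periodic = χ-periodic
    ; binary   = indicator-binary X
    ; X0≡0     = χ0≡0
    ; equation = equation
    ; 0<a      = subst (λ m → 0ℤ ℤ.< m) t≡μ (+<+ t-pos)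
    ; a<2∣X∣   = subst₂ ℤ._<_ t≡μ k≡2∑χ (+<+ t<k)
    }
    where
    open IsDSRG dsrg
    o : Fin n
    o = residue n 0ℤ
    o≡0 : ⟦ o ⟧ ≡ 0ℤ
    o≡0 = cong +_ (trans (toℕ-fromℕ< (n%ℕd<d 0ℤ n)) (ℕ.m<n⇒m%n≡m (ℕ.>-nonZero⁻¹ n)))
    -o : ∀ z → z - ⟦ o ⟧ ≡ z
    -o z = trans (cong (_-_ z) o≡0) (ℤ.+-identityʳ z)
    χ0≡0 : χ 0ℤ ≡ 0ℤ
    χ0≡0 = ∉⇒indicator X 0ℤ (0∉X o (ℤ.+-injective o≡0))
    k≡2∑χ : + k ≡ + 2 * ∑ n χ
    k≡2∑χ = begin
      + k                                            ≡⟨ cong +_ (sym (outReg (o , false))) ⟩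
      + count (allD n) (λ y → arc (o , false) y)     ≡⟨ outDegree o false ⟩
      ∑ n (λ z → + 2 * χ (z - ⟦ o ⟧))                ≡⟨ ∑-cong n (λ z → cong (λ y → + 2 * χ y) (-o z)) ⟩
      ∑ n (λ z → + 2 * χ z)                          ≡⟨ *-distribˡ-∑ n (+ 2) χ ⟩
      + 2 * ∑ n χ                                    ∎
    fromOrigin : ∀ x b → ∑ n (λ i → χ i * symmetrize χ (x - i))
      ≡ + t * ind ⌊ (o , false) ≟D (residue n x , b) ⌋ + + lam * χ x
        + + μ * (1ℤ - ind ⌊ (o , false) ≟D (residue n x , b) ⌋ - χ x)
    fromOrigin x b = begin
      ∑ n (λ i → χ i * symmetrize χ (x - i))
        ≡⟨ ∑-cong n (λ i → cong₂ _*_ (cong χ (sym (-o i))) (periodic-∣ {f = symmetrize χ} Y-periodic {x - i} {⟦ residue n x ⟧ - i} (residue-step i))) ⟩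
      ∑ n (λ i → χ (i - ⟦ o ⟧) * symmetrize χ (⟦ residue n x ⟧ - i))
        ≡⟨ sym (twoStepPaths o false (residue n x) b) ⟩
      + count (allD n) (λ z → arc (o , false) z ∧ arc z (residue n x , b))
        ≡⟨ square (o , false) (residue n x , b) ⟩
      + t * d + + lam * ind (arc (o , false) (residue n x , b)) + + μ * (1ℤ - d - ind (arc (o , false) (residue n x , b)))
        ≡⟨ cong (λ u → + t * d + + lam * u + + μ * (1ℤ - d - u)) arc≡χ ⟩
      + t * d + + lam * χ x + + μ * (1ℤ - d - χ x) ∎
      where
      d = ind ⌊ (o , false) ≟D (residue n x , b) ⌋
      Y-periodic : Periodic n (symmetrize χ)
      Y-periodic = symmetrize-periodic {X = χ} χ-periodic
      residue-step : ∀ i → + n ∣ (x - i) - (⟦ residue n x ⟧ - i)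
      residue-step i = subst (+ n ∣_) (rearrange x i ⟦ residue n x ⟧) (residue-∣ n x)
        where
        rearrange : ∀ x i r → x - r ≡ (x - i) - (r - i)
        rearrange = solve-∀
      arc≡χ : ind (arc (o , false) (residue n x , b)) ≡ χ x
      arc≡χ = trans (ind-arc o false (residue n x) b) (trans (cong χ (-o ⟦ residue n x ⟧))
        (sym (periodic-∣ {f = χ} χ-periodic {x} (residue-∣ n x))))
    -- A reflection is never the identity, so with `b = true` the diagonal terms disappear.
    equation : ∀ x → ∑ n (λ i → χ i * symmetrize χ (x - i)) ≡ + μ - (+ μ - + lam) * χ x
    equation x = trans (fromOrigin x true)
      (trans (cong (λ d → + t * ind d + + lam * χ x + + μ * (1ℤ - ind d - χ x))
               (⌊⌋-false ((o , false) ≟D (residue n x , true)) (λ ())))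
        (rearrange (+ t) (+ lam) (+ μ) (χ x)))
      where
      rearrange : ∀ t l m x → t * 0ℤ + l * x + m * (1ℤ - 0ℤ - x) ≡ m - (m - l) * x
      rearrange = solve-∀
    -- There are as many two-step paths from the identity to itself, namely `t`, as to the
    -- reflection with exponent 0, namely `μ`.
    t≡μ : + t ≡ + μ
    t≡μ = begin
      + t                                                  ≡⟨ atOrigin (+ t) (+ lam) (+ μ) ⟩
      + t * 1ℤ + + lam * 0ℤ + + μ * (1ℤ - 1ℤ - 0ℤ)
        ≡⟨ cong₂ (λ d u → + t * ind d + + lam * u + + μ * (1ℤ - ind d - u))
             (sym (⌊⌋-true ((o , false) ≟D (o , false)) refl)) (sym χ0≡0) ⟩
      + t * d + + lam * χ 0ℤ + + μ * (1ℤ - d - χ 0ℤ)       ≡⟨ sym (fromOrigin 0ℤ false) ⟩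
      ∑ n (λ i → χ i * symmetrize χ (0ℤ - i))              ≡⟨ equation 0ℤ ⟩
      + μ - (+ μ - + lam) * χ 0ℤ                           ≡⟨ cong (λ u → + μ - (+ μ - + lam) * u) χ0≡0 ⟩
      + μ - (+ μ - + lam) * 0ℤ                             ≡⟨ drop (+ μ) (+ μ - + lam) ⟩
      + μ                                                  ∎
      where
      d = ind ⌊ (o , false) ≟D (o , false) ⌋
      atOrigin : ∀ t l m → t ≡ t * 1ℤ + l * 0ℤ + m * (1ℤ - 1ℤ - 0ℤ)
      atOrigin = solve-∀
      drop : ∀ m c → m - c * 0ℤ ≡ m
      drop = solve-∀

  -- Here X + X⁽⁻¹⁾ = G − K with K = MG of order r, so X(X + X⁽⁻¹⁾) = |X|G − rX.
  tournament⇒dsrg : ∀ {r M} .{{_ : NonZero M}} → n ≡ r ℕ.* M → ¬ (+ M ∣ 1ℤ) → Periodic M χ →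
    (∀ x → symmetrize χ x ≡ 1ℤ - δ M x) → IsDSRGDih n X X
  tournament⇒dsrg {r} {M} n≡rM M∤1 χ-M-periodic Y≡1-δ =
    -- The parameters are `k = 2|X|`, `μ = t = |X|` and `λ = |X| - r`; the absolute values only
    -- convert integers, shown below to be nonnegative, to naturals.
    params (length (allD n)) (∣ + 2 * S ∣) (∣ S ∣) (∣ S - + r ∣) (∣ S ∣) , record
    { order  = refl
    ; outReg = λ (i , b) → ℤ.+-injective (trans (outDegree i b) (trans (*-distribˡ-∑ n (+ 2) (λ z → χ (signed b (z - ⟦ i ⟧))))
        (trans (cong (+ 2 *_) (∑-signed b i)) (sym (ℤ.0≤i⇒+∣i∣≡i 0≤2S)))))
    ; inReg  = λ (j , c) → ℤ.+-injective (trans (inDegree j c) (trans (∑-reflect-shift Y-periodic ⟦ j ⟧)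
        (trans (trans (∑-distrib-+ n χ (λ z → χ (- z))) (cong (_+_ S) (∑-reflect χ-periodic)))
          (trans (twice S) (sym (ℤ.0≤i⇒+∣i∣≡i 0≤2S))))))
    ; square = λ (i , b) (j , c) → trans (twoStepPaths i b j c) (trans (∑-step b i j)
        (trans (equation (signed b (⟦ j ⟧ - ⟦ i ⟧))) (trans (cong (λ u → S - + r * u) (sym (ind-arc i b j c)))
          (trans (regroup S (+ r) (ind ⌊ (i , b) ≟D (j , c) ⌋) (ind (arc (i , b) (j , c))))
            (cong₂ (λ s l → s * ind ⌊ (i , b) ≟D (j , c) ⌋ + l * ind (arc (i , b) (j , c))
                + s * (1ℤ - ind ⌊ (i , b) ≟D (j , c) ⌋ - ind (arc (i , b) (j , c))))
              (sym (ℤ.0≤i⇒+∣i∣≡i 0≤S)) (sym (ℤ.0≤i⇒+∣i∣≡i 0≤S-r)))))))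
    ; t-pos  = ℤ.drop‿+<+ (subst (0ℤ ℤ.<_) (sym (ℤ.0≤i⇒+∣i∣≡i 0≤S)) 0<S)
    ; t<k    = ℤ.drop‿+<+ (subst₂ ℤ._<_ (sym (ℤ.0≤i⇒+∣i∣≡i 0≤S)) (sym (ℤ.0≤i⇒+∣i∣≡i 0≤2S)) S<2S)
    }
    where
    S : ℤ
    S = ∑ n χ
    Y : ℤ → ℤ
    Y = symmetrize χ
    Y-periodic : Periodic n Y
    Y-periodic = symmetrize-periodic {X = χ} χ-periodic
    Y-even : ∀ x → Y (- x) ≡ Y x
    Y-even = symmetrize-even χ
    twice : ∀ s → s + s ≡ + 2 * s
    twice = solve-∀
    regroup : ∀ s r d u → s - r * u ≡ s * d + (s - r) * u + s * (1ℤ - d - u)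
    regroup = solve-∀
    ∑-signed : ∀ b i → ∑ n (λ z → χ (signed b (z - ⟦ i ⟧))) ≡ S
    ∑-signed false i = trans (∑-cong n (λ z → cong χ (ℤ.+-comm z (- ⟦ i ⟧)))) (∑-shift χ-periodic (- ⟦ i ⟧))
    ∑-signed true  i = trans (∑-cong n (λ z → cong χ (flip z ⟦ i ⟧))) (∑-reflect-shift χ-periodic ⟦ i ⟧)
      where
      flip : ∀ z i → - (z - i) ≡ i - z
      flip = solve-∀
    -- The start of the path is moved to exponent 0. If it is a reflection, the index is also
    -- reflected, which `Y` allows, being even.
    ∑-step : ∀ b i j → ∑ n (λ z → χ (signed b (z - ⟦ i ⟧)) * Y (⟦ j ⟧ - z))
      ≡ ∑ n (λ z → χ z * Y (signed b (⟦ j ⟧ - ⟦ i ⟧) - z))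
    ∑-step b i j = trans (∑-cong n (pointwise b)) (recentre b)
      where
      F : ℤ → ℤ
      F z = χ z * Y (signed b (⟦ j ⟧ - ⟦ i ⟧) - z)
      F-periodic : Periodic n F
      F-periodic z = cong₂ _*_ (χ-periodic z) (periodic-reflect {f = Y} Y-periodic (signed b (⟦ j ⟧ - ⟦ i ⟧)) z)
      pointwise : ∀ b z → χ (signed b (z - ⟦ i ⟧)) * Y (⟦ j ⟧ - z)
        ≡ χ (signed b (z - ⟦ i ⟧)) * Y (signed b (⟦ j ⟧ - ⟦ i ⟧) - signed b (z - ⟦ i ⟧))
      pointwise false z = cong (λ y → χ (z - ⟦ i ⟧) * Y y) (eq ⟦ i ⟧ ⟦ j ⟧ z)
        where
        eq : ∀ i j z → j - z ≡ (j - i) - (z - i)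
        eq = solve-∀
      pointwise true z = cong (χ (- (z - ⟦ i ⟧)) *_) (trans (sym (Y-even (⟦ j ⟧ - z))) (cong Y (eq ⟦ i ⟧ ⟦ j ⟧ z)))
        where
        eq : ∀ i j z → - (j - z) ≡ - (j - i) - - (z - i)
        eq = solve-∀
      recentre : ∀ b′ → ∑ n (λ z → F (signed b′ (z - ⟦ i ⟧))) ≡ ∑ n F
      recentre false = trans (∑-cong n (λ z → cong F (ℤ.+-comm z (- ⟦ i ⟧)))) (∑-shift F-periodic (- ⟦ i ⟧))
      recentre true  = trans (∑-cong n (λ z → cong F (flip z ⟦ i ⟧))) (∑-reflect-shift F-periodic ⟦ i ⟧)
        where
        flip : ∀ z i → - (z - i) ≡ i - z
        flip = solve-∀
    equation : ∀ u → ∑ n (λ z → χ z * Y (u - z)) ≡ S - + r * χ u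
    equation u = begin
      ∑ n (λ z → χ z * Y (u - z))               ≡⟨ ∑-cong n (λ z → trans (cong (χ z *_) (Y≡1-δ (u - z))) (expand (χ z) (δ M (u - z)))) ⟩
      ∑ n (λ z → χ z - χ z * δ M (u - z))       ≡⟨ ∑-distrib-- n χ (λ z → χ z * δ M (u - z)) ⟩
      S - ∑ n (λ z → χ z * δ M (u - z))         ≡⟨ cong (λ k → S - ∑ k (λ z → χ z * δ M (u - z))) n≡rM ⟩
      S - ∑ (r ℕ.* M) (λ z → χ z * δ M (u - z)) ≡⟨ cong (_-_ S) (trans (∑-blocks per r) (cong (+ r *_) (∑-*-δ M χ-M-periodic u))) ⟩
      S - + r * χ u                             ∎
      where
      expand : ∀ x d → x * (1ℤ - d) ≡ x - x * d
      expand = solve-∀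
      per : Periodic M (λ z → χ z * δ M (u - z))
      per z = cong₂ _*_ (χ-M-periodic z) (periodic-reflect (δ-periodic M) u z)
    Y1≡1 : χ 1ℤ + χ (- 1ℤ) ≡ 1ℤ
    Y1≡1 = trans (Y≡1-δ 1ℤ) (cong (_-_ 1ℤ) (δ-∤ M∤1))
    -- As `M` does not divide 1, one of `1` and `- 1` belongs to `X`, which is therefore nonempty.
    member : ∃[ u ] χ u ≡ 1ℤ
    member with indicator-binary X 1ℤ | indicator-binary X (- 1ℤ)
    ... | inj₂ h | _       = 1ℤ , h
    ... | inj₁ _ | inj₂ h′ = - 1ℤ , h′
    ... | inj₁ h | inj₁ h′ = contradiction (trans (sym (cong₂ _+_ h h′)) Y1≡1) (λ ())
    0≤χ : ∀ z → 0ℤ ℤ.≤ χ z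
    0≤χ = binary-nonNeg (indicator-binary X)
    0≤S : 0ℤ ℤ.≤ S
    0≤S = ∑-nonNeg n 0≤χ
    0<S : 0ℤ ℤ.< S
    0<S = ℤ.≤∧≢⇒< 0≤S (λ 0≡S → contradiction
      (trans (sym (proj₂ member)) (∑≡0⇒≡0 n χ-periodic 0≤χ (sym 0≡S) (proj₁ member))) (λ ()))
    0≤2S : 0ℤ ℤ.≤ + 2 * S
    0≤2S = subst (0ℤ ℤ.≤_) (twice S) (ℤ.+-mono-≤ 0≤S 0≤S)
    S<2S : S ℤ.< + 2 * S
    S<2S = subst₂ ℤ._<_ (ℤ.+-identityʳ S) (twice S) (ℤ.+-monoʳ-< S 0<S)
    -- At a member of `X` the right side of the equation is `S - r`, and the left side is a sum of
    -- nonnegative terms.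
    0≤S-r : 0ℤ ℤ.≤ S - + r
    0≤S-r = subst (0ℤ ℤ.≤_) (trans (equation (proj₁ member)) (cong (_-_ S) (trans (cong (+ r *_) (proj₂ member)) (ℤ.*-identityʳ (+ r)))))
      (∑-nonNeg n (λ z → 0≤product (indicator-binary X z) (0≤Y (proj₁ member - z))))
      where
      0≤Y : ∀ x → 0ℤ ℤ.≤ Y x
      0≤Y x = ℤ.+-mono-≤ (0≤χ x) (0≤χ (- x))
      0≤product : ∀ {u v} → u ≡ 0ℤ ⊎ u ≡ 1ℤ → 0ℤ ℤ.≤ v → 0ℤ ℤ.≤ u * v
      0≤product {v = v} (inj₁ refl) 0≤v = ℤ.≤-reflexive (sym (ℤ.*-zeroˡ v))
      0≤product {v = v} (inj₂ refl) 0≤v = subst (0ℤ ℤ.≤_) (sym (ℤ.*-identityˡ v)) 0≤v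

-- Preimages of subsets of a quotient

ind≡1⇒≡true : ∀ b → ind b ≡ 1ℤ → b ≡ true
ind≡1⇒≡true true _ = refl

∤-nonzero : ∀ {M} (h : Fin M) → ¬ (toℕ h ≡ 0) → ¬ (+ M ∣ ⟦ h ⟧)
∤-nonzero h h≢0 M∣h = h≢0 (ℤ.+-injective (∣∧abs<⇒≡0 M∣h (toℕ<n h)))

module _ {n M : ℕ} .{{_ : NonZero n}} .{{_ : NonZero M}} (X : Subset n) where
  open Dihedrant X using (χ; χ-periodic)

  IsPreimageOfTournament : Subset M → Set
  IsPreimageOfTournament H = (∀ x → (x ∈ X) ⇔ (residue M ⟦ x ⟧ ∈ H))
    × (∀ h → (h ∈ H ⊎ h ∈- H) ⇔ (¬ toℕ h ≡ 0))
    × (∀ h → ¬ (h ∈ H × h ∈- H))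

  -- `H` is the restriction of `χ` to `0, …, M - 1`. Periodicity makes `X` its full preimage, and
  -- two binary values with sum 1 are 0 and 1 in some order.
  image : Periodic M χ → χ 0ℤ ≡ 0ℤ → (∀ x → ¬ (+ M ∣ x) → symmetrize χ x ≡ 1ℤ) →
    Σ (Subset M) IsPreimageOfTournament
  image per χ0≡0 Y≡1 = H , preimage , cover , disjoint
    where
    H : Subset M
    H = tabulate (λ h → does (residue n ⟦ h ⟧ ∈? X))
    ∈H⇒χ : ∀ h → h ∈ H → χ ⟦ h ⟧ ≡ 1ℤ
    ∈H⇒χ h h∈H = cong ind (trans (sym (lookup∘tabulate (λ h → does (residue n ⟦ h ⟧ ∈? X)) h)) ([]=⇒lookup h∈H))
    χ⇒∈H : ∀ h → χ ⟦ h ⟧ ≡ 1ℤ → h ∈ H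
    χ⇒∈H h eq = lookup⇒[]= h H (trans (lookup∘tabulate (λ h → does (residue n ⟦ h ⟧ ∈? X)) h) (ind≡1⇒≡true _ eq))
    χ-residue : ∀ z → χ ⟦ residue M z ⟧ ≡ χ z
    χ-residue z = sym (periodic-∣ {f = χ} per {z} (residue-∣ M z))
    χ-neg : ∀ h → χ ⟦ -ₙ h ⟧ ≡ χ (- ⟦ h ⟧)
    χ-neg h = trans (cong (λ k → χ ⟦ k ⟧) (-ₙ-residue M h)) (χ-residue (- ⟦ h ⟧))
    χ-zero : ∀ h → toℕ h ≡ 0 → χ ⟦ h ⟧ ≡ 0ℤ × χ (- ⟦ h ⟧) ≡ 0ℤ
    χ-zero h h≡0 = trans (cong (λ k → χ (+ k)) h≡0) χ0≡0 , trans (cong (λ k → χ (- + k)) h≡0) χ0≡0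
    preimage : ∀ x → (x ∈ X) ⇔ (residue M ⟦ x ⟧ ∈ H)
    preimage x = mk⇔
      (λ x∈X → χ⇒∈H _ (trans (χ-residue ⟦ x ⟧) (∈⇒indicator X ⟦ x ⟧ (subst (_∈ X) (sym (residue-⟦⟧ n x)) x∈X))))
      (λ r∈H → subst (_∈ X) (residue-⟦⟧ n x) (indicator⇒∈ X ⟦ x ⟧ (trans (sym (χ-residue ⟦ x ⟧)) (∈H⇒χ _ r∈H))))
    cover : ∀ h → (h ∈ H ⊎ h ∈- H) ⇔ (¬ toℕ h ≡ 0)
    cover h = mk⇔ to from
      where
      to : h ∈ H ⊎ h ∈- H → ¬ toℕ h ≡ 0
      to (inj₁ h∈H)  h≡0 = contradiction (trans (sym (∈H⇒χ h h∈H)) (proj₁ (χ-zero h h≡0))) (λ ())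
      to (inj₂ -h∈H) h≡0 = contradiction (trans (sym (trans (sym (χ-neg h)) (∈H⇒χ (-ₙ h) -h∈H))) (proj₂ (χ-zero h h≡0))) (λ ())
      from : ¬ toℕ h ≡ 0 → h ∈ H ⊎ h ∈- H
      from h≢0 with indicator-binary X ⟦ h ⟧ | indicator-binary X (- ⟦ h ⟧)
      ... | inj₂ eq | _        = inj₁ (χ⇒∈H h eq)
      ... | inj₁ _  | inj₂ eq  = inj₂ (χ⇒∈H (-ₙ h) (trans (χ-neg h) eq))
      ... | inj₁ eq | inj₁ eq′ = contradiction (trans (sym (cong₂ _+_ eq eq′)) (Y≡1 ⟦ h ⟧ (∤-nonzero h h≢0))) (λ ())
    disjoint : ∀ h → ¬ (h ∈ H × h ∈- H)
    disjoint h (h∈H , -h∈H) = contradiction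
      (trans (sym (cong₂ _+_ (∈H⇒χ h h∈H) (trans (sym (χ-neg h)) (∈H⇒χ (-ₙ h) -h∈H))))
        (Y≡1 ⟦ h ⟧ (∤-nonzero h (Equivalence.to (cover h) (inj₁ h∈H))))) (λ ())

  -- Since `M` divides `n`, the indicators of `X` and `H` agree as functions on ℤ, so `χ` has period
  -- `M` and (i) and (ii) give `X + X⁽⁻¹⁾ = G - K`.
  preimage⇒dsrg : ∀ r → n ≡ r ℕ.* M → ¬ (+ M ∣ 1ℤ) → Σ (Subset M) IsPreimageOfTournament → IsDSRGDih n X X
  preimage⇒dsrg r n≡rM M∤1 (H , preimage , cover , disjoint) =
    tournament⇒dsrg X {r} {M} n≡rM M∤1 (λ x → trans (χ≡χH (x + + M)) (trans (indicator-periodic H x) (sym (χ≡χH x)))) Y≡1-δ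
    where
    M∣n : + M ∣ + n
    M∣n = divides (+ r) (trans (cong +_ n≡rM) (ℤ.pos-* r M))
    residue-residue : ∀ z → residue M ⟦ residue n z ⟧ ≡ residue M z
    residue-residue z = sym (residue-cong M z ⟦ residue n z ⟧ (∣-trans M∣n (residue-∣ n z)))
    χ≡χH : ∀ z → χ z ≡ indicator H z
    χ≡χH z with residue n z ∈? X
    ... | yes z∈X = sym (∈⇒indicator H z (subst (_∈ H) (residue-residue z) (Equivalence.to (preimage (residue n z)) z∈X)))
    ... | no z∉X  = sym (∉⇒indicator H z (λ r∈H → z∉X (Equivalence.from (preimage (residue n z))
                      (subst (_∈ H) (sym (residue-residue z)) r∈H))))
    residue-neg : ∀ x → -ₙ residue M x ≡ residue M (- x)
    residue-neg x = trans (-ₙ-residue M (residue M x)) (residue-cong M (- ⟦ residue M x ⟧) (- x)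
      (subst (+ M ∣_) (rearrange x ⟦ residue M x ⟧) (residue-∣ M x)))
      where
      rearrange : ∀ x r → x - r ≡ - r - - x
      rearrange = solve-∀
    ∣⇒residue≡0 : ∀ x → + M ∣ x → toℕ (residue M x) ≡ 0
    ∣⇒residue≡0 x M∣x = ℤ.+-injective (∣∧abs<⇒≡0 {i = ⟦ residue M x ⟧}
      (subst (+ M ∣_) (rearrange x ⟦ residue M x ⟧) (∣m∣n⇒∣m-n M∣x (residue-∣ M x))) (toℕ<n (residue M x)))
      where
      rearrange : ∀ x r → x - (x - r) ≡ r
      rearrange = solve-∀
    residue≡0⇒∣ : ∀ x → toℕ (residue M x) ≡ 0 → + M ∣ x
    residue≡0⇒∣ x r≡0 = subst (+ M ∣_) (trans (cong (λ k → x - + k) r≡0) (ℤ.+-identityʳ x)) (residue-∣ M x)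
    YH : ∀ x → indicator H x + indicator H (- x) ≡ 1ℤ - δ M x
    YH x with + M ∣? x
    ... | yes M∣x = cong₂ _+_
      (∉⇒indicator H x (λ h∈H → Equivalence.to (cover (residue M x)) (inj₁ h∈H) (∣⇒residue≡0 x M∣x)))
      (∉⇒indicator H (- x) (λ -h∈H → Equivalence.to (cover (residue M x))
        (inj₂ (subst (_∈ H) (sym (residue-neg x)) -h∈H)) (∣⇒residue≡0 x M∣x)))
    ... | no M∤x with Equivalence.from (cover (residue M x)) (λ r≡0 → M∤x (residue≡0⇒∣ x r≡0))
    ... | inj₁ h∈H  = cong₂ _+_ (∈⇒indicator H x h∈H)
      (∉⇒indicator H (- x) (λ -h∈H → disjoint (residue M x) (h∈H , subst (_∈ H) (sym (residue-neg x)) -h∈H)))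
    ... | inj₂ -h∈H = cong₂ _+_
      (∉⇒indicator H x (λ h∈H → disjoint (residue M x) (h∈H , -h∈H)))
      (∈⇒indicator H (- x) (subst (_∈ H) (residue-neg x) -h∈H))
    Y≡1-δ : ∀ x → symmetrize χ x ≡ 1ℤ - δ M x
    Y≡1-δ x = trans (cong₂ _+_ (χ≡χH x) (χ≡χH (- x))) (YH x)

-- The characterization for odd prime powers

oddPrime>2 : ∀ {p} → Prime p → p % 2 ≡ 1 → 2 < p
oddPrime>2 {0} pr ()
oddPrime>2 {1} pr _ = contradiction pr ¬prime[1]
oddPrime>2 {2} pr ()
oddPrime>2 {suc (suc (suc _))} pr _ = s≤s (s≤s (s≤s z≤n))

theorem6p1 : (p α : ℕ) → (pr : Prime p) → p % 2 ≡ 1 → 1 ≤ α →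
    (X : Subset (p ^ α)) → (∀ x → toℕ x ≡ 0 → x ∉ X) →
    IsDSRGDih (p ^ α) X X
    ⇔ (∃[ γ ] (1 ≤ γ × γ ≤ α × (Σ (Subset (p ^ γ)) λ H →
    (∀ x → (x ∈ X) ⇔ (ψ pr γ x ∈ H))
    × (∀ h → (h ∈ H ⊎ h ∈- H) ⇔ (¬ toℕ h ≡ 0))
    × (∀ h → ¬ (h ∈ H × h ∈- H)))))
theorem6p1 p α pr p%2≡1 1≤α X 0∉X = mk⇔ to from
  where
  p^≢0 : ∀ γ → NonZero (p ^ γ)
  p^≢0 γ = ℕ.m^n≢0 p γ {{prime⇒nonZero pr}}
  instance
    p^α≢0 : NonZero (p ^ α)
    p^α≢0 = p^≢0 α
  2<p : 2 < p
  2<p = oddPrime>2 pr p%2≡1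
  ψ≡residue : ∀ γ x → ψ pr γ x ≡ residue (p ^ γ) {{p^≢0 γ}} ⟦ x ⟧
  ψ≡residue γ x = mod-residue (toℕ x) (p ^ γ) {{p^≢0 γ}}
  fromImage : ∀ γ → 1 ≤ γ → γ ≤ α → Σ (Subset (p ^ γ)) (IsPreimageOfTournament {{p^α≢0}} {{p^≢0 γ}} X) → _
  fromImage γ 1≤γ γ≤α (H , preimage , rest) = γ , 1≤γ , γ≤α , H ,
    (λ x → subst (λ r → (x ∈ X) ⇔ (r ∈ H)) (sym (ψ≡residue γ x)) (preimage x)) , rest
  fromSolution : ∃[ a ] ∃[ c ] Solution (p ^ α) (indicator X) a c → _
  fromSolution (a , c , sol) =
    let γ , 1≤γ , γ≤α , per , Y≡1 = PrimePowerSolutions.classify pr 2<p α sol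
    in fromImage γ 1≤γ γ≤α (image {{p^α≢0}} {{p^≢0 γ}} X per (Solution.X0≡0 sol) Y≡1)
  to : IsDSRGDih (p ^ α) X X → _
  to dsrg = fromSolution (dsrg⇒solution X 0∉X dsrg)
  from : _ → IsDSRGDih (p ^ α) X X
  -- The kernel of `ψ` has order `r = p^α / p^γ`; the modulus `p ^ γ` does not divide 1 because
  -- `1 ≤ γ`.
  from (γ , 1≤γ , γ≤α , H , preimage , rest) = preimage⇒dsrg {{p^α≢0}} {{p^≢0 γ}} X (ℕ.quotient p^γ∣p^α) (ℕ._∣_.equality p^γ∣p^α) p^γ∤1
    (H , (λ x → subst (λ r → (x ∈ X) ⇔ (r ∈ H)) (ψ≡residue γ x) (preimage x)) , rest)
    where
    p^γ∣p^α : p ^ γ ℕ.∣ p ^ α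
    p^γ∣p^α = ^-monoʳ-∣ p γ≤α
    p^γ∤1 : ¬ (+ (p ^ γ) ∣ 1ℤ)
    p^γ∤1 d = ℕ.>⇒∤ (ℕ.<-trans (s≤s (s≤s z≤n)) 2<p)
      (ℕ.∣-trans (subst (ℕ._∣ p ^ γ) (ℕ.^-identityʳ p) (^-monoʳ-∣ p 1≤γ)) (∣⇒∣ᵤ d))
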